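{- Let $k\ge1$. Then $H_{\frac{f_{2k+1}}{2}+1,\,f_{2k+3}-1}=(-1)^{k+1}\frac{f_{2k+1}}{2}$.
   Context: Let $\tau$ be the substitution on $\{0,1\}$ with $\tau(1)=101$, $\tau(0)=1$ (extended to words by concatenation), and let $\mathbf{s}=(s_j)_{j\ge 0}=\lim_{j\to\infty}\tau^j(1)$ be its fixed point beginning with $1$. For $m\ge 0$, $n\ge 1$, $H_{m,n}=\det(s_{m+i+j})_{0\le i,j\le n-1}$. Define $f_{2j}=|\tau^j(1)|$, $f_{2j+1}=|\tau^j(10)|$ ($|w|$ = length of $w$); equivalently $f_0=1$, $f_1=2$, $f_{2j+2}=f_{2j}+f_{2j+1}$, $f_{2j+3}=f_{2j}+f_{2j+2}$; the $f_{2j+1}$ are even. -}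

module Defs where

open import Data.Nat using (ℕ; zero; suc; _+_; _∸_; _/_)
open import Data.Integer as ℤ using (ℤ; +_; -_)
open import Data.List using (List; []; _∷_; _++_; length; concatMap; lookup)
open import Data.Fin using (Fin; zero; suc; toℕ; punchIn)
open import Data.Bool using (Bool; true; false)

-- letters 0 and 1 as natural numbers (only 0 and 1 occur)
-- substitution τ : 1 ↦ 101, 0 ↦ 1
τ₁ : ℕ → List ℕ
τ₁ zero = 1 ∷ []
τ₁ (suc _) = 1 ∷ 0 ∷ 1 ∷ []

τ : List ℕ → List ℕ
τ = concatMap τ₁

τ^ : ℕ → List ℕ → List ℕ
τ^ zero w = w
τ^ (suc j) w = τ (τ^ j w)

at : List ℕ → ℕ → ℕ
at [] _ = 0
at (x ∷ xs) zero = x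
at (x ∷ xs) (suc n) = at xs n

-- the fixed point s = lim τ^j(1); since τ^j(1) is a prefix of τ^(j+1)(1)
-- and |τ^(j+1)(1)| ≥ j+2 > j, the j-th letter of s is the j-th letter of τ^(j+1)(1)
s : ℕ → ℕ
s j = at (τ^ (suc j) (1 ∷ [])) j

f : ℕ → ℕ
f n with n Data.Nat.% 2
... | zero = length (τ^ (n / 2) (1 ∷ []))
... | suc _ = length (τ^ (n / 2) (1 ∷ 0 ∷ []))

det : (n : ℕ) → (Fin n → Fin n → ℤ) → ℤ
det zero M = + 1
det (suc n) M = go (suc n) (λ j → j)
  where
  sign : ℕ → ℤ
  sign zero = + 1
  sign (suc zero) = - (+ 1)
  sign (suc (suc k)) = sign k
  minor : Fin (suc n) → Fin n → Fin n → ℤ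
  minor j a b = M (suc a) (punchIn j b)
  -- sum over columns j given by an enumeration of the first k of them
  go : (k : ℕ) → (Fin k → Fin (suc n)) → ℤ
  go zero _ = + 0
  go (suc k) e = (sign (toℕ (e zero)) ℤ.* (M zero (e zero) ℤ.* det n (minor (e zero))))
                   ℤ.+ go k (λ i → e (suc i))

H : ℕ → ℕ → ℤ
H m n = det n (λ i j → + s (m + toℕ i + toℕ j))

neg1^ : ℕ → ℤ
neg1^ zero = + 1
neg1^ (suc n) = - (+ 1) ℤ.* neg1^ n

{-# OPTIONS --safe #-}

-- Write w = τ^k(1), u = τ^k(0), so that τ^(k+1)(1) = w u w. The words w u and u w differ only
-- by exchanging two adjacent letters. Hence two rows of the Hankel matrix whose indices differ
-- by |w| or by |w u w| differ by ± a step vector e_c − e_{c+1} (or e_{n−1}), and the steps so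
-- obtained occupy two antidiagonal blocks around the row and column |w| − 1. Replacing every
-- row except row |w| − 1 by such a difference does not change the determinant: along these
-- differences a fixed linear functional changes by 1, always in the same direction, so the row
-- operations can be ordered.
-- The remaining row is expanded in the steps; its coefficient at the missing step e_c − e_{c+1},
-- c = |w| − 1, counts the letters 1 in a conjugate of w, which is f_{2k+1}/2. What is left is
-- the sign of the two antidiagonal blocks, both of even size.
module Submission where

open import Defs
open import Data.Bool using (if_then_else_)
open import Data.Fin using (Fin; zero; suc; toℕ; fromℕ; fromℕ<; punchIn; pinch; _↑ˡ_; _↑ʳ_)
open import Data.Fin.Properties using (_≟_; any?; punchInᵢ≢i; suc-injective; toℕ<n; toℕ-injective; toℕ-fromℕ; toℕ-fromℕ<; toℕ-↑ˡ; toℕ-↑ʳ)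
open import Data.Integer using (ℤ; +_; -[1+_]; -_; _+_; _*_; _-_; ∣_∣)
open import Data.Integer.Properties using (+-*-semiring; *-assoc; *-identityˡ; *-identityʳ; *-zeroʳ; +-assoc; +-identityˡ; +-identityʳ; ⊖-≥)
open import Data.Integer.Tactic.RingSolver using (solve-∀)
open import Data.List using (List; []; _∷_; _++_; length; take; drop)
open import Data.List.Properties using (length-++; ++-monoid; take++drop≡id; length-take; ++-assoc; ++-identityʳ; concatMap-++)
open import Data.Nat as ℕ using (ℕ; zero; suc; z≤n; s≤s)
open import Data.Nat.DivMod using (_%_; _/_; [m+kn]%n≡m%n; m<n⇒m%n≡m; +-distrib-/-∣ʳ; m*n/n≡m)
open import Data.Nat.Divisibility using (divides)
open import Data.Nat.ListAction using () renaming (sum to total)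
open import Data.Nat.ListAction.Properties using () renaming (sum-++ to total-++)
import Data.Nat.Properties as ℕ
open import Data.Nat.Tactic.RingSolver using () renaming (solve-∀ to ℕ-solve-∀)
open import Data.Product using (_×_; _,_; ∃; proj₁; proj₂)
open import Data.Sum using (_⊎_; inj₁; inj₂)
open import Data.Vec.Functional using (updateAt)
open import Data.Vec.Functional.Properties using (updateAt-updates; updateAt-minimal)
open import Function using (_∘_; const)
open import Relation.Binary.Definitions using (tri<; tri≈; tri>)
open import Relation.Binary.PropositionalEquality
open import Relation.Nullary using (yes; no; contradiction; does)
open import Relation.Nullary.Decidable using (dec-true; dec-false)
open import Tactic.MonoidSolver using (solve)
open import Algebra.Properties.Semiring.Sum +-*-semiring using (sum; sum-cong-≗; ∑-distrib-+; *-distribˡ-sum; sum-replicate-zero; sum-remove)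

open ≡-Reasoning

-- Determinants

-- The window is tuned to the places where the fixed point differs from its shifts. Put N =
-- f_{2k+1}/2, and let m = N + 1 be the start of the window and n its order. Against the shift by
-- |w| the first exchanged pair sits at places N - 1 and N, so m is the first start past it; the
-- next pair sits at m + n - 1 and m + n, because n + 1 = |w| + |wuw|. Against the shift by |wuw|
-- the first pair sits at m + |w| - 2 and m + |w| - 1. The differences of rows are therefore
-- supported on two adjacent antidiagonals. The obstacle is the order of the row operations: the row
-- subtracted must still be unchanged, yet it may itself be due for replacement, so chains of
-- subtractions must not close up. Arithmetically this amounts to |w| and |wuw| being coprime. The
-- functional with weights n - j replaces that argument: up to the sign ε it grows by one along
-- every difference, which excludes cycles.

Matrix : ℕ → ℕ → Set
Matrix m n = Fin m → Fin n → ℤ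

minor : ∀ {n} → Matrix (suc n) (suc n) → Fin (suc n) → Matrix n n
minor M j a b = M (suc a) (punchIn j b)

cofactorTerm : ∀ {n} → Matrix (suc n) (suc n) → Fin (suc n) → ℤ
cofactorTerm {n} M j = neg1^ (toℕ j) * (M zero j * det n (minor M j))

partialExpansion : ∀ {n} → Matrix (suc n) (suc n) → (k : ℕ) → (Fin k → Fin (suc n)) → ℤ
partialExpansion M zero e = + 0
partialExpansion M (suc k) e = cofactorTerm M (e zero) + partialExpansion M k (λ i → e (suc i))

neg1^-+2 : ∀ z → neg1^ (suc (suc z)) ≡ neg1^ z
neg1^-+2 z = trans (sym (*-assoc (- (+ 1)) (- (+ 1)) (neg1^ z))) (*-identityˡ (neg1^ z))

-- The argument `t` stands for the summation loop inside `det`, with the sign index and the term of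
-- the current column split off as `z` and `A`. There is one equation for each shape on which that
-- loop computes, so each can be supplied by `refl`; together they determine `t`, the last one
-- because signs have period two.
partialExpansion-unique :
  ∀ {n} (M : Matrix (suc n) (suc n)) (t : ℕ → ℤ → (k : ℕ) → (Fin k → Fin (suc n)) → ℤ) →
  let next = λ k (e : Fin (suc k) → Fin (suc n)) →
               t (toℕ (e zero)) (M zero (e zero) * det n (minor M (e zero))) k (λ i → e (suc i)) in
  (∀ A e → t 0 A 0 e ≡ + 1 * A + + 0) →
  (∀ A e → t 1 A 0 e ≡ - (+ 1) * A + + 0) →
  (∀ A k e → t 0 A (suc k) e ≡ + 1 * A + next k e) →
  (∀ A k e → t 1 A (suc k) e ≡ - (+ 1) * A + next k e) →
  (∀ z A k e → t (suc (suc z)) A k e ≡ t z A k e) →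
  ∀ z A k e → t z A k e ≡ neg1^ z * A + partialExpansion M k e
partialExpansion-unique M t t00 t10 t0s t1s tss = go
  where
  go : ∀ z A k e → t z A k e ≡ neg1^ z * A + partialExpansion M k e
  go 0 A zero e = t00 A e
  go 1 A zero e = t10 A e
  go 0 A (suc k) e = trans (t0s A k e) (cong (λ u → + 1 * A + u) (go (toℕ (e zero)) _ k _))
  go 1 A (suc k) e = trans (t1s A k e) (cong (λ u → - (+ 1) * A + u) (go (toℕ (e zero)) _ k _))
  go (suc (suc z)) A k e = trans (tss z A k e) (trans (go z A k e)
    (cong (λ c → c * A + partialExpansion M k e) (sym (neg1^-+2 z))))

-- det's local summation loop has no accessible name: expansionTail is left to
-- unification, which finds it once with-abstraction has made the loop's
-- arguments in det (suc (suc n)) M distinct variables.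
expansionTail : ∀ n → Matrix (suc n) (suc n) → ℕ → ℤ → (k : ℕ) → (Fin k → Fin (suc n)) → ℤ
det-partialExpansion : ∀ n (M : Matrix (suc n) (suc n)) →
                       det (suc n) M ≡ partialExpansion M (suc n) (λ j → j)
expansionTail = _
det-partialExpansion zero M = refl
det-partialExpansion (suc n) M
  with + 1 * (M zero zero * det (suc n) (minor M zero))
     | - (+ 1) * (M zero (suc zero) * det (suc n) (minor M (suc zero)))
... | x | y with suc n | (λ (i : Fin n) → Fin.suc (Fin.suc i))
det-partialExpansion (suc zero) M | x | y | N | e = refl
det-partialExpansion (suc (suc n)) M | x | y | N | e
  with toℕ (e zero) | M zero (e zero) * det N (minor M (e zero)) | (λ i → e (suc i))
... | z | A | e′ = cong (λ u → x + (y + u))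
  (partialExpansion-unique M (expansionTail N M)
    (λ _ _ → refl) (λ _ _ → refl) (λ _ _ _ → refl) (λ _ _ _ → refl) (λ _ _ _ _ → refl) z A n e′)

laplace : ∀ n (M : Matrix (suc n) (suc n)) → det (suc n) M ≡ sum (cofactorTerm M)
laplace n M = trans (det-partialExpansion n M) (as-sum (suc n) (λ j → j))
  where
  as-sum : ∀ k e → partialExpansion M k e ≡ sum (λ i → cofactorTerm M (e i))
  as-sum zero e = refl
  as-sum (suc k) e = cong (λ u → cofactorTerm M (e zero) + u) (as-sum k (λ i → e (suc i)))

sum-zero : ∀ {n} (f : Fin n → ℤ) → (∀ i → f i ≡ + 0) → sum f ≡ + 0
sum-zero {n} f f≡0 = trans (sum-cong-≗ f≡0) (sum-replicate-zero n)

sum-single : ∀ {n} (f : Fin n → ℤ) i → (∀ j → j ≢ i → f j ≡ + 0) → sum f ≡ f i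
sum-single {suc n} f i f≡0 = begin
  sum f                            ≡⟨ sum-remove f ⟩
  f i + sum (λ j → f (punchIn i j)) ≡⟨ cong (λ u → f i + u) (sum-zero _ (λ j → f≡0 _ (punchInᵢ≢i i j))) ⟩
  f i + + 0                        ≡⟨ +-identityʳ (f i) ⟩
  f i                              ∎

sum-linear : ∀ {n} a b (f g : Fin n → ℤ) → sum (λ i → a * f i + b * g i) ≡ a * sum f + b * sum g
sum-linear a b f g = trans (∑-distrib-+ (λ i → a * f i) (λ i → b * g i))
  (sym (cong₂ _+_ (*-distribˡ-sum a f) (*-distribˡ-sum b g)))

det-cong : ∀ n {A B : Matrix n n} → (∀ i j → A i j ≡ B i j) → det n A ≡ det n B
det-cong zero A≡B = refl
det-cong (suc n) {A} {B} A≡B = begin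
  det (suc n) A        ≡⟨ laplace n A ⟩
  sum (cofactorTerm A) ≡⟨ sum-cong-≗ (λ j → cong (λ u → neg1^ (toℕ j) * u)
                            (cong₂ _*_ (A≡B zero j) (det-cong n (λ a b → A≡B (suc a) (punchIn j b))))) ⟩
  sum (cofactorTerm B) ≡⟨ sym (laplace n B) ⟩
  det (suc n) B        ∎

det-linear : ∀ n (r : Fin n) {A B C : Matrix n n} a b →
             (∀ j → C r j ≡ a * A r j + b * B r j) →
             (∀ i → i ≢ r → ∀ j → A i j ≡ C i j) →
             (∀ i → i ≢ r → ∀ j → B i j ≡ C i j) →
             det n C ≡ a * det n A + b * det n B
det-linear (suc n) r {A} {B} {C} a b Cr A≡C B≡C = begin
  det (suc n) C                                              ≡⟨ laplace n C ⟩
  sum (cofactorTerm C)                                       ≡⟨ sum-cong-≗ (term r Cr A≡C B≡C) ⟩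
  sum (λ j → a * cofactorTerm A j + b * cofactorTerm B j)    ≡⟨ sum-linear a b (cofactorTerm A) (cofactorTerm B) ⟩
  a * sum (cofactorTerm A) + b * sum (cofactorTerm B)        ≡⟨ sym (cong₂ (λ u v → a * u + b * v) (laplace n A) (laplace n B)) ⟩
  a * det (suc n) A + b * det (suc n) B                      ∎
  where
  distrib₁ : ∀ a b s x y d → s * ((a * x + b * y) * d) ≡ a * (s * (x * d)) + b * (s * (y * d))
  distrib₁ = solve-∀
  distrib₂ : ∀ a b s x d e → s * (x * (a * d + b * e)) ≡ a * (s * (x * d)) + b * (s * (x * e))
  distrib₂ = solve-∀
  term : ∀ r → (∀ j → C r j ≡ a * A r j + b * B r j) →
         (∀ i → i ≢ r → ∀ j → A i j ≡ C i j) → (∀ i → i ≢ r → ∀ j → B i j ≡ C i j) →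
         ∀ j → cofactorTerm C j ≡ a * cofactorTerm A j + b * cofactorTerm B j
  term zero Cr A≡C B≡C j = begin
    σ * (C zero j * det n (minor C j))                        ≡⟨ cong (λ u → σ * (u * det n (minor C j))) (Cr j) ⟩
    σ * ((a * A zero j + b * B zero j) * det n (minor C j))   ≡⟨ distrib₁ a b σ (A zero j) (B zero j) _ ⟩
    a * (σ * (A zero j * det n (minor C j))) + b * (σ * (B zero j * det n (minor C j)))
      ≡⟨ cong₂ (λ u v → a * (σ * (A zero j * u)) + b * (σ * (B zero j * v)))
           (det-cong n (λ i k → sym (A≡C (suc i) (λ ()) _))) (det-cong n (λ i k → sym (B≡C (suc i) (λ ()) _))) ⟩
    a * cofactorTerm A j + b * cofactorTerm B j               ∎
    where σ = neg1^ (toℕ j)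
  term (suc r) Cr A≡C B≡C j = begin
    σ * (C zero j * det n (minor C j))
      ≡⟨ cong (λ u → σ * (C zero j * u)) (det-linear n r a b (λ k → Cr (punchIn j k))
           (λ i i≢r k → A≡C (suc i) (i≢r ∘ suc-injective) _) (λ i i≢r k → B≡C (suc i) (i≢r ∘ suc-injective) _)) ⟩
    σ * (C zero j * (a * det n (minor A j) + b * det n (minor B j)))
      ≡⟨ distrib₂ a b σ (C zero j) (det n (minor A j)) (det n (minor B j)) ⟩
    a * (σ * (C zero j * det n (minor A j))) + b * (σ * (C zero j * det n (minor B j)))
      ≡⟨ sym (cong₂ (λ u v → a * (σ * (u * det n (minor A j))) + b * (σ * (v * det n (minor B j))))
           (A≡C zero (λ ()) j) (B≡C zero (λ ()) j)) ⟩
    a * cofactorTerm A j + b * cofactorTerm B j               ∎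
    where σ = neg1^ (toℕ j)

-- pinch l j is the place of j after the column punchIn j l has been deleted.
punchIn-pinch : ∀ {n} (j : Fin (suc n)) (l : Fin n) → punchIn (punchIn j l) (pinch l j) ≡ j
punchIn-pinch {suc n} zero l = refl
punchIn-pinch (suc j) zero = refl
punchIn-pinch (suc j) (suc l) = cong suc (punchIn-pinch j l)

-- Both sides skip the columns `j` and `punchIn j l`, deleted in opposite orders; hence a twofold
-- minor depends only on the unordered pair of columns.
punchIn-swap : ∀ {n} (j : Fin (suc (suc n))) (l : Fin (suc n)) x →
               punchIn j (punchIn l x) ≡ punchIn (punchIn j l) (punchIn (pinch l j) x)
punchIn-swap zero l x = refl
punchIn-swap (suc j) zero x = refl
punchIn-swap (suc j) (suc l) zero = refl
punchIn-swap {suc n} (suc j) (suc l) (suc x) = cong suc (punchIn-swap j l x)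

signedPairSum : ∀ n → (Fin (suc n) → Fin n → ℤ) → ℤ
signedPairSum n F = sum (λ j → neg1^ (toℕ j) * sum (λ l → neg1^ (toℕ l) * F j l))

-- Exchanging the two columns of a pair, (j, l) ↦ (punchIn j l, pinch l j), flips the sign, so the
-- terms cancel in pairs. In the induction row 0 of the sum cancels against column 0, and what
-- remains is the same sum one size smaller.
signedPairSum-symmetric : ∀ n (F : Fin (suc n) → Fin n → ℤ) →
  (∀ j l → F j l ≡ F (punchIn j l) (pinch l j)) → signedPairSum n F ≡ + 0
signedPairSum-symmetric zero F F-sym = refl
signedPairSum-symmetric (suc n) F F-sym = begin
  + 1 * r₀ + sum (λ j → - (+ 1) * neg1^ (toℕ j) * (+ 1 * F (suc j) zero + sum (λ l → - (+ 1) * neg1^ (toℕ l) * F (suc j) (suc l))))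
    ≡⟨ cong (λ u → + 1 * r₀ + u) (sum-cong-≗ (λ j → trans
         (cong₂ (λ u v → - (+ 1) * neg1^ (toℕ j) * (+ 1 * u + v)) (F-sym (suc j) zero) (pull j))
         (rearrange (neg1^ (toℕ j)) (F zero j) (inner j)))) ⟩
  + 1 * r₀ + sum (λ j → - (+ 1) * (neg1^ (toℕ j) * F zero j) + + 1 * (neg1^ (toℕ j) * inner j))
    ≡⟨ cong (λ u → + 1 * r₀ + u) (sum-linear (- (+ 1)) (+ 1) (λ j → neg1^ (toℕ j) * F zero j) (λ j → neg1^ (toℕ j) * inner j)) ⟩
  + 1 * r₀ + (- (+ 1) * r₀ + + 1 * signedPairSum n (λ j l → F (suc j) (suc l)))
    ≡⟨ cong (λ u → + 1 * r₀ + (- (+ 1) * r₀ + + 1 * u))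
         (signedPairSum-symmetric n (λ j l → F (suc j) (suc l)) (λ j l → F-sym (suc j) (suc l))) ⟩
  + 1 * r₀ + (- (+ 1) * r₀ + + 1 * + 0)
    ≡⟨ cancel r₀ ⟩
  + 0 ∎
  where
  r₀ : ℤ
  r₀ = sum (λ l → neg1^ (toℕ l) * F zero l)
  inner : Fin (suc n) → ℤ
  inner j = sum (λ l → neg1^ (toℕ l) * F (suc j) (suc l))
  pull : ∀ j → sum (λ l → - (+ 1) * neg1^ (toℕ l) * F (suc j) (suc l)) ≡ - (+ 1) * inner j
  pull j = trans (sum-cong-≗ (λ l → *-assoc (- (+ 1)) (neg1^ (toℕ l)) (F (suc j) (suc l))))
                 (sym (*-distribˡ-sum (- (+ 1)) (λ l → neg1^ (toℕ l) * F (suc j) (suc l))))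
  rearrange : ∀ s x y → - (+ 1) * s * (+ 1 * x + - (+ 1) * y) ≡ - (+ 1) * (s * x) + + 1 * (s * y)
  rearrange = solve-∀
  cancel : ∀ x → + 1 * x + (- (+ 1) * x + + 1 * + 0) ≡ + 0
  cancel = solve-∀

-- Expanding along rows 0 and 1 gives a signed sum over ordered pairs of columns; as both rows carry
-- the same entries, exchanging the pair leaves the unsigned summand unchanged.
det-equal-first-rows : ∀ n (M : Matrix (suc (suc n)) (suc (suc n))) →
  (∀ j → M zero j ≡ M (suc zero) j) → det (suc (suc n)) M ≡ + 0
det-equal-first-rows n M M₀≡M₁ = begin
  det (suc (suc n)) M    ≡⟨ laplace (suc n) M ⟩
  sum (cofactorTerm M)   ≡⟨ sum-cong-≗ expand ⟩
  signedPairSum (suc n) F ≡⟨ signedPairSum-symmetric (suc n) F F-sym ⟩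
  + 0                    ∎
  where
  F : Fin (suc (suc n)) → Fin (suc n) → ℤ
  F j l = M zero j * (M zero (punchIn j l) * det n (minor (minor M j) l))
  commute : ∀ s x y d → x * (s * (y * d)) ≡ s * (x * (y * d))
  commute = solve-∀
  swap : ∀ x y d → x * (y * d) ≡ y * (x * d)
  swap = solve-∀
  expand : ∀ j → cofactorTerm M j ≡ neg1^ (toℕ j) * sum (λ l → neg1^ (toℕ l) * F j l)
  expand j = cong (λ u → neg1^ (toℕ j) * u) (begin
    M zero j * det (suc n) (minor M j)         ≡⟨ cong (λ u → M zero j * u) (laplace n (minor M j)) ⟩
    M zero j * sum (cofactorTerm (minor M j))  ≡⟨ *-distribˡ-sum (M zero j) (cofactorTerm (minor M j)) ⟩
    sum (λ l → M zero j * cofactorTerm (minor M j) l)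
      ≡⟨ sum-cong-≗ (λ l → trans (commute (neg1^ (toℕ l)) (M zero j) (M (suc zero) (punchIn j l)) _)
           (cong (λ u → neg1^ (toℕ l) * (M zero j * (u * det n (minor (minor M j) l)))) (sym (M₀≡M₁ (punchIn j l))))) ⟩
    sum (λ l → neg1^ (toℕ l) * F j l)          ∎)
  F-sym : ∀ j l → F j l ≡ F (punchIn j l) (pinch l j)
  F-sym j l = trans (swap (M zero j) (M zero (punchIn j l)) _) (cong (λ u → M zero (punchIn j l) * u)
    (cong₂ _*_ (cong (M zero) (sym (punchIn-pinch j l)))
      (det-cong n (λ a b → cong (M (suc (suc a))) (punchIn-swap j l b)))))

det-equal-rows : ∀ n (M : Matrix n n) r r′ → r ≢ r′ → (∀ j → M r j ≡ M r′ j) → det n M ≡ + 0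

det-equal-tail-rows : ∀ n (M : Matrix (suc n) (suc n)) r r′ → r ≢ r′ →
                      (∀ j → M (suc r) j ≡ M (suc r′) j) → det (suc n) M ≡ + 0
det-equal-tail-rows n M r r′ r≢r′ Mr≡Mr′ = trans (laplace n M) (sum-zero _ (λ j →
  trans (cong (λ u → neg1^ (toℕ j) * (M zero j * u))
          (det-equal-rows n (minor M j) r r′ r≢r′ (λ k → Mr≡Mr′ (punchIn j k))))
        (vanish (neg1^ (toℕ j)) (M zero j))))
  where
  vanish : ∀ s x → s * (x * + 0) ≡ + 0
  vanish = solve-∀

-- With u in rows 0 and i and x in row 1, expanding the vanishing determinant with
-- u + x in both rows 0 and 1 leaves only cases of equal adjacent or of equal lower rows.
det-equal-first-row : ∀ n (M : Matrix (suc n) (suc n)) i → (∀ j → M zero j ≡ M (suc i) j) → det (suc n) M ≡ + 0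
det-equal-first-row (suc n) M zero M₀≡Mᵢ = det-equal-first-rows n M M₀≡Mᵢ
det-equal-first-row (suc n) M (suc i) M₀≡Mᵢ = begin
  det (suc (suc n)) M   ≡⟨ det-cong (suc (suc n)) M≡ux ⟩
  det _ (rows u x)      ≡⟨ isolate (det _ (rows u u)) (det _ (rows u x)) (det _ (rows x u)) (det _ (rows x x))
                             (det-equal-first-rows n (rows u u) (λ _ → refl))
                             (det-equal-tail-rows (suc n) (rows x u) zero (suc i) (λ ()) M₀≡Mᵢ)
                             (det-equal-first-rows n (rows x x) (λ _ → refl))
                             (trans (sym both) (det-equal-first-rows n (rows u+x u+x) (λ _ → refl))) ⟩
  + 0                   ∎
  where
  u x u+x : Fin (suc (suc n)) → ℤ
  u = M zero
  x = M (suc zero)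
  u+x j = + 1 * u j + + 1 * x j
  rows : (p q : Fin (suc (suc n)) → ℤ) → Matrix (suc (suc n)) (suc (suc n))
  rows p q zero = p
  rows p q (suc zero) = q
  rows p q (suc (suc k)) = M (suc (suc k))
  M≡ux : ∀ i j → M i j ≡ rows u x i j
  M≡ux zero j = refl
  M≡ux (suc zero) j = refl
  M≡ux (suc (suc i)) j = refl
  first : ∀ q → det _ (rows u+x q) ≡ + 1 * det _ (rows u q) + + 1 * det _ (rows x q)
  first q = det-linear _ zero (+ 1) (+ 1) (λ j → refl) (off u) (off x)
    where
    off : ∀ p i → i ≢ zero → ∀ j → rows p q i j ≡ rows u+x q i j
    off p zero 0≢0 j = contradiction refl 0≢0
    off p (suc zero) _ j = refl
    off p (suc (suc i)) _ j = refl
  second : ∀ p → det _ (rows p u+x) ≡ + 1 * det _ (rows p u) + + 1 * det _ (rows p x)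
  second p = det-linear _ (suc zero) (+ 1) (+ 1) (λ j → refl) (off u) (off x)
    where
    off : ∀ q i → i ≢ suc zero → ∀ j → rows p q i j ≡ rows p u+x i j
    off q zero _ j = refl
    off q (suc zero) 1≢1 j = contradiction refl 1≢1
    off q (suc (suc i)) _ j = refl
  both : det _ (rows u+x u+x) ≡ + 1 * (+ 1 * det _ (rows u u) + + 1 * det _ (rows u x))
                              + + 1 * (+ 1 * det _ (rows x u) + + 1 * det _ (rows x x))
  both = trans (first u+x) (cong₂ (λ a b → + 1 * a + + 1 * b) (second u) (second x))
  isolate : ∀ uu ux xu xx → uu ≡ + 0 → xu ≡ + 0 → xx ≡ + 0 →
            + 1 * (+ 1 * uu + + 1 * ux) + + 1 * (+ 1 * xu + + 1 * xx) ≡ + 0 → ux ≡ + 0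
  isolate _ ux _ _ refl refl refl eq = trans (simplify ux) eq
    where
    simplify : ∀ a → a ≡ + 1 * (+ 1 * + 0 + + 1 * a) + + 1 * (+ 1 * + 0 + + 1 * + 0)
    simplify = solve-∀

det-equal-rows (suc n) M zero zero 0≢0 _ = contradiction refl 0≢0
det-equal-rows (suc n) M zero (suc r′) _ eq = det-equal-first-row n M r′ eq
det-equal-rows (suc n) M (suc r) zero _ eq = det-equal-first-row n M r (λ j → sym (eq j))
det-equal-rows (suc n) M (suc r) (suc r′) r≢r′ eq = det-equal-tail-rows n M r r′ (r≢r′ ∘ cong suc) eq

-- Replacing a single row

infixl 20 _[_≔_]
_[_≔_] : ∀ {m n} → Matrix m n → Fin m → (Fin n → ℤ) → Matrix m n
M [ r ≔ u ] = updateAt M r (const u)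

updated-row : ∀ {m n} (M : Matrix m n) r u j → (M [ r ≔ u ]) r j ≡ u j
updated-row M r u j = cong (λ row → row j) (updateAt-updates r M)

other-row : ∀ {m n} (M : Matrix m n) r u i → i ≢ r → ∀ j → (M [ r ≔ u ]) i j ≡ M i j
other-row M r u i i≢r j = cong (λ row → row j) (updateAt-minimal i r M i≢r)

update-agrees : ∀ {m n} (M : Matrix m n) r u v i → i ≢ r → ∀ j → (M [ r ≔ u ]) i j ≡ (M [ r ≔ v ]) i j
update-agrees M r u v i i≢r j = trans (other-row M r u i i≢r j) (sym (other-row M r v i i≢r j))

det-update-linear : ∀ n (M : Matrix n n) r a b u v →
  det n (M [ r ≔ (λ j → a * u j + b * v j) ]) ≡ a * det n (M [ r ≔ u ]) + b * det n (M [ r ≔ v ])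
det-update-linear n M r a b u v = det-linear n r {M [ r ≔ u ]} {M [ r ≔ v ]} {M [ r ≔ w ]} a b
  (λ j → trans (updated-row M r w j)
    (sym (cong₂ (λ x y → a * x + b * y) (updated-row M r u j) (updated-row M r v j))))
  (update-agrees M r u w) (update-agrees M r v w)
  where
  w = λ j → a * u j + b * v j

update-cong : ∀ {m n} (M : Matrix m n) r {u v} → (∀ j → u j ≡ v j) → ∀ i j → (M [ r ≔ u ]) i j ≡ (M [ r ≔ v ]) i j
update-cong M r {u} {v} u≡v i j with i ≟ r
... | yes refl = trans (updated-row M r u j) (trans (u≡v j) (sym (updated-row M r v j)))
... | no i≢r = update-agrees M r u v i i≢r j

det-update-sum : ∀ n (M : Matrix n n) r m (a : Fin m → ℤ) (R : Matrix m n) →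
  det n (M [ r ≔ (λ j → sum (λ v → a v * R v j)) ]) ≡ sum (λ v → a v * det n (M [ r ≔ R v ]))
det-update-sum n M r zero a R = trans
  (det-cong n (update-cong M r (λ j → refl)))
  (det-update-linear n M r (+ 0) (+ 0) (λ _ → + 0) (λ _ → + 0))
det-update-sum n M r (suc m) a R = begin
  det n (M [ r ≔ (λ j → a zero * R zero j + tail j) ])
    ≡⟨ det-cong n (update-cong M r (λ j → cong (λ u → a zero * R zero j + u) (sym (*-identityˡ (tail j))))) ⟩
  det n (M [ r ≔ (λ j → a zero * R zero j + + 1 * tail j) ])
    ≡⟨ det-update-linear n M r (a zero) (+ 1) (R zero) tail ⟩
  a zero * det n (M [ r ≔ R zero ]) + + 1 * det n (M [ r ≔ tail ])
    ≡⟨ cong (λ u → a zero * det n (M [ r ≔ R zero ]) + u)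
         (trans (*-identityˡ _) (det-update-sum n M r m (λ v → a (suc v)) (λ v → R (suc v)))) ⟩
  sum (λ v → a v * det n (M [ r ≔ R v ])) ∎
  where
  tail : Fin n → ℤ
  tail j = sum (λ v → a (suc v) * R (suc v) j)

det-update-repeat : ∀ n (M : Matrix n n) r v → v ≢ r → det n (M [ r ≔ M v ]) ≡ + 0
det-update-repeat n M r v v≢r = det-equal-rows n (M [ r ≔ M v ]) r v (v≢r ∘ sym)
  (λ j → trans (updated-row M r (M v) j) (sym (other-row M r (M v) v v≢r j)))

-- A term with `M v` for v ≠ r repeats a row and vanishes, so only the coefficient of the replaced
-- row survives. As in Cramer's rule, this reads off one coefficient of an expansion.
det-update-combination : ∀ n (M : Matrix n n) r (a : Fin n → ℤ) →
  det n (M [ r ≔ (λ j → sum (λ v → a v * M v j)) ]) ≡ a r * det n M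
det-update-combination n M r a = begin
  det n (M [ r ≔ (λ j → sum (λ v → a v * M v j)) ])  ≡⟨ det-update-sum n M r n a M ⟩
  sum (λ v → a v * det n (M [ r ≔ M v ]))
    ≡⟨ sum-single _ r (λ v v≢r → trans (cong (λ u → a v * u) (det-update-repeat n M r v v≢r)) (*-zeroʳ (a v))) ⟩
  a r * det n (M [ r ≔ M r ])                        ≡⟨ cong (λ u → a r * u) (det-cong n unchanged) ⟩
  a r * det n M                                      ∎
  where
  unchanged : ∀ i j → (M [ r ≔ M r ]) i j ≡ M i j
  unchanged i j with i ≟ r
  ... | yes refl = updated-row M r (M r) j
  ... | no i≢r = other-row M r (M r) i i≢r j

-- Row operations in the order of a rank

Reduces : ∀ {n} → (Fin n → ℕ) → Matrix n n → Matrix n n → Set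
Reduces κ A B = ∀ v → (∀ j → B v j ≡ A v j) ⊎ ∃ λ p → κ p ℕ.< κ v × (∀ j → B v j ≡ A v j - A p j)

module _ {n : ℕ} {κ : Fin n → ℕ} {A B : Matrix n n} (red : Reduces κ A B) where

  -- Rows are replaced in decreasing order of key: at time `T` exactly those with key at least `T`
  -- have their final form. A row `p` to be subtracted has a smaller key, so it is still the row of
  -- `A`, as `Reduces` demands.
  stage : ℕ → Matrix n n
  stage T v = if does (T ℕ.≤? κ v) then B v else A v

  stage-B : ∀ {T v} → T ℕ.≤ κ v → ∀ j → stage T v j ≡ B v j
  stage-B {T} {v} T≤ j rewrite dec-true (T ℕ.≤? κ v) T≤ = refl

  stage-A : ∀ {T v} → κ v ℕ.< T → ∀ j → stage T v j ≡ A v j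
  stage-A {T} {v} <T j rewrite dec-false (T ℕ.≤? κ v) (ℕ.<⇒≱ <T) = refl

  stage-unaffected : ∀ T v → κ v ≢ T → ∀ j → stage T v j ≡ stage (suc T) v j
  stage-unaffected T v κv≢T j with T ℕ.≤? κ v
  ... | yes T≤ = trans (stage-B T≤ j) (sym (stage-B (ℕ.≤∧≢⇒< T≤ (κv≢T ∘ sym)) j))
  ... | no T≰ = trans (stage-A (ℕ.≰⇒> T≰) j) (sym (stage-A (ℕ.m<n⇒m<1+n (ℕ.≰⇒> T≰)) j))

  det-stage-step : (∀ {u v} → κ u ≡ κ v → u ≡ v) → ∀ T → det n (stage T) ≡ det n (stage (suc T))
  det-stage-step κ-inj T with any? (λ v → κ v ℕ.≟ T)
  ... | no none = det-cong n (λ v → stage-unaffected T v (λ κv≡T → none (v , κv≡T)))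
  ... | yes (v , κv≡T) with red v
  ...   | inj₁ Bv≡Av = det-cong n same
    where
    same : ∀ i j → stage T i j ≡ stage (suc T) i j
    same i j with i ≟ v
    ... | yes refl = trans (stage-B (ℕ.≤-reflexive (sym κv≡T)) j)
                       (trans (Bv≡Av j) (sym (stage-A (s≤s (ℕ.≤-reflexive κv≡T)) j)))
    ... | no i≢v = stage-unaffected T i (λ κi≡T → i≢v (κ-inj (trans κi≡T (sym κv≡T)))) j
  ...   | inj₂ (p , p<v , Bv≡) = begin
    det n (stage T)
      -- Row `v` of `stage T` is row `v` of `S` minus row `p` of `S`. Splitting along it leaves
      -- `det n S` and a determinant in which row `p` occurs twice.
      ≡⟨ det-linear n v {S} {S [ v ≔ S p ]} (+ 1) (- (+ 1)) row-v
           (λ i i≢v j → sym (unaffected i i≢v j))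
           (λ i i≢v j → trans (other-row S v (S p) i i≢v j) (sym (unaffected i i≢v j))) ⟩
    + 1 * det n S + - (+ 1) * det n (S [ v ≔ S p ])
      ≡⟨ cong (λ u → + 1 * det n S + - (+ 1) * u) (det-update-repeat n S v p (λ p≡v → ℕ.<-irrefl (cong κ p≡v) p<v)) ⟩
    + 1 * det n S + - (+ 1) * + 0
      ≡⟨ simplify (det n S) ⟩
    det n S ∎
    where
    S : Matrix n n
    S = stage (suc T)
    unaffected : ∀ i → i ≢ v → ∀ j → stage T i j ≡ S i j
    unaffected i i≢v = stage-unaffected T i (λ κi≡T → i≢v (κ-inj (trans κi≡T (sym κv≡T))))
    simplify : ∀ x → + 1 * x + - (+ 1) * + 0 ≡ x
    simplify = solve-∀
    as-combination : ∀ x y → x - y ≡ + 1 * x + - (+ 1) * y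
    as-combination = solve-∀
    row-v : ∀ j → stage T v j ≡ + 1 * S v j + - (+ 1) * (S [ v ≔ S p ]) v j
    row-v j = begin
      stage T v j                  ≡⟨ stage-B (ℕ.≤-reflexive (sym κv≡T)) j ⟩
      B v j                        ≡⟨ Bv≡ j ⟩
      A v j - A p j                ≡⟨ sym (cong₂ _-_ (stage-A (s≤s (ℕ.≤-reflexive κv≡T)) j)
                                        (stage-A (ℕ.m<n⇒m<1+n (subst (κ p ℕ.<_) κv≡T p<v)) j)) ⟩
      S v j - S p j                ≡⟨ as-combination (S v j) (S p j) ⟩
      + 1 * S v j + - (+ 1) * S p j ≡⟨ cong (λ u → + 1 * S v j + - (+ 1) * u) (sym (updated-row S v (S p) j)) ⟩
      + 1 * S v j + - (+ 1) * (S [ v ≔ S p ]) v j ∎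

  det-stage : (∀ {u v} → κ u ≡ κ v → u ≡ v) → ∀ T → det n B ≡ det n (stage T)
  det-stage κ-inj zero = det-cong n (λ i j → sym (stage-B z≤n j))
  det-stage κ-inj (suc T) = trans (det-stage κ-inj T) (det-stage-step κ-inj T)

  det-injective-reduction : (∀ {u v} → κ u ≡ κ v → u ≡ v) → ∀ K → (∀ v → κ v ℕ.< K) → det n B ≡ det n A
  det-injective-reduction κ-inj K κ<K = trans (det-stage κ-inj K) (det-cong n (λ i → stage-A (κ<K i)))

bound : ∀ {n} → (Fin n → ℕ) → ℕ
bound {zero} ρ = 0
bound {suc n} ρ = suc (ρ zero) ℕ.⊔ bound (λ i → ρ (suc i))

<bound : ∀ {n} (ρ : Fin n → ℕ) i → ρ i ℕ.< bound ρ
<bound ρ zero = ℕ.m≤m⊔n (suc (ρ zero)) (bound (λ i → ρ (suc i)))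
<bound ρ (suc i) = ℕ.<-≤-trans (<bound (λ i → ρ (suc i)) i) (ℕ.m≤n⊔m (suc (ρ zero)) _)

-- Ties of the rank are broken by the index: the key ρ v * n + v is injective.
det-reduction : ∀ n (ρ : Fin n → ℕ) (A B : Matrix n n) → Reduces ρ A B → det n B ≡ det n A
det-reduction zero ρ A B red = refl
det-reduction n@(suc _) ρ A B red = det-injective-reduction red′ κ-inj (bound κ) (<bound κ)
  where
  κ : Fin n → ℕ
  κ v = toℕ v ℕ.+ ρ v ℕ.* n
  κ-mod : ∀ v → κ v % n ≡ toℕ v
  κ-mod v = trans ([m+kn]%n≡m%n (toℕ v) (ρ v) n) (m<n⇒m%n≡m (toℕ<n v))
  κ-inj : ∀ {u v} → κ u ≡ κ v → u ≡ v
  κ-inj {u} {v} eq = toℕ-injective (trans (sym (κ-mod u)) (trans (cong (_% n) eq) (κ-mod v)))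
  κ-mono : ∀ p v → ρ p ℕ.< ρ v → κ p ℕ.< κ v
  κ-mono p v p<v = ℕ.<-≤-trans (ℕ.+-monoˡ-< (ρ p ℕ.* n) (toℕ<n p))
    (ℕ.≤-trans (ℕ.*-monoˡ-≤ n p<v) (ℕ.m≤n+m (ρ v ℕ.* n) (toℕ v)))
  red′ : Reduces κ A B
  red′ v with red v
  ... | inj₁ same = inj₁ same
  ... | inj₂ (p , p<v , eq) = inj₂ (p , κ-mono p v p<v , eq)

-- Kronecker delta and antidiagonal blocks

δ : ℕ → ℕ → ℤ
δ zero zero = + 1
δ zero (suc y) = + 0
δ (suc x) zero = + 0
δ (suc x) (suc y) = δ x y

δ-refl : ∀ x → δ x x ≡ + 1
δ-refl zero = refl
δ-refl (suc x) = δ-refl x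

δ-≢ : ∀ x y → x ≢ y → δ x y ≡ + 0
δ-≢ zero zero 0≢0 = contradiction refl 0≢0
δ-≢ zero (suc y) _ = refl
δ-≢ (suc x) zero _ = refl
δ-≢ (suc x) (suc y) x≢y = δ-≢ x y (x≢y ∘ cong suc)

δ-sym : ∀ x y → δ x y ≡ δ y x
δ-sym zero zero = refl
δ-sym zero (suc y) = refl
δ-sym (suc x) zero = refl
δ-sym (suc x) (suc y) = δ-sym x y

δ-+ : ∀ z x y → δ (z ℕ.+ x) (z ℕ.+ y) ≡ δ x y
δ-+ zero x y = refl
δ-+ (suc z) x y = δ-+ z x y

toℕ-punchIn-< : ∀ {n} (c : Fin (suc n)) j → toℕ j ℕ.< toℕ c → toℕ (punchIn c j) ≡ toℕ j
toℕ-punchIn-< (suc c) zero _ = refl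
toℕ-punchIn-< (suc c) (suc j) (s≤s j<c) = cong suc (toℕ-punchIn-< c j j<c)

toℕ-punchIn-≥ : ∀ {n} (c : Fin (suc n)) j → toℕ c ℕ.≤ toℕ j → toℕ (punchIn c j) ≡ suc (toℕ j)
toℕ-punchIn-≥ zero j _ = refl
toℕ-punchIn-≥ (suc c) (suc j) (s≤s c≤j) = cong suc (toℕ-punchIn-≥ c j c≤j)

neg1^-consecutive : ∀ a → neg1^ (suc a) * neg1^ a ≡ - (+ 1)
neg1^-consecutive zero = refl
neg1^-consecutive (suc a) = trans (rotate (neg1^ a)) (neg1^-consecutive a)
  where
  rotate : ∀ x → - (+ 1) * (- (+ 1) * x) * (- (+ 1) * x) ≡ - (+ 1) * x * x
  rotate = solve-∀

antidiagonalDet : ℤ → ℕ → ℤ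
antidiagonalDet ε zero = + 1
antidiagonalDet ε (suc a) = neg1^ a * (ε * antidiagonalDet ε a)

module _ (ε : ℤ) where

  -- The first row has its only nonzero entry in column a - 1, and deleting that row and column
  -- leaves the same shape with a - 1 for a. The entries below the block may be arbitrary, since the
  -- prescribed rows vanish to the right of it.
  det-antidiagonal-block : ∀ a n (M : Matrix (a ℕ.+ n) (a ℕ.+ n)) →
    (∀ i j → toℕ i ℕ.< a → M i j ≡ ε * δ (suc (toℕ i ℕ.+ toℕ j)) a) →
    det (a ℕ.+ n) M ≡ antidiagonalDet ε a * det n (λ i j → M (a ↑ʳ i) (a ↑ʳ j))
  det-antidiagonal-block zero n M top = sym (*-identityˡ _)
  det-antidiagonal-block (suc a) n M top = begin
    det (suc (a ℕ.+ n)) M                 ≡⟨ laplace (a ℕ.+ n) M ⟩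
    sum (cofactorTerm M)                  ≡⟨ sum-single (cofactorTerm M) last off-last ⟩
    neg1^ (toℕ last) * (M zero last * det (a ℕ.+ n) (minor M last))
      ≡⟨ cong₂ (λ x y → neg1^ x * (y * det (a ℕ.+ n) (minor M last))) toℕ-last M₀last ⟩
    neg1^ a * (ε * det (a ℕ.+ n) (minor M last))
      ≡⟨ cong (λ u → neg1^ a * (ε * u)) (det-antidiagonal-block a n (minor M last) minor-top) ⟩
    neg1^ a * (ε * (antidiagonalDet ε a * det n (λ i j → M (suc a ↑ʳ i) (punchIn last (a ↑ʳ j)))))
      ≡⟨ cong (λ u → neg1^ a * (ε * (antidiagonalDet ε a * u)))
           (det-cong n (λ i j → cong (M (suc a ↑ʳ i)) (punchIn-last a j))) ⟩
    neg1^ a * (ε * (antidiagonalDet ε a * D))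
      ≡⟨ reassociate (neg1^ a) ε (antidiagonalDet ε a) D ⟩
    antidiagonalDet ε (suc a) * D ∎
    where
    last : Fin (suc (a ℕ.+ n))
    last = fromℕ a ↑ˡ n
    D : ℤ
    D = det n (λ i j → M (suc a ↑ʳ i) (suc a ↑ʳ j))
    toℕ-last : toℕ last ≡ a
    toℕ-last = trans (toℕ-↑ˡ (fromℕ a) n) (toℕ-fromℕ a)
    M₀last : M zero last ≡ ε
    M₀last = trans (top zero last (s≤s z≤n)) (trans (cong (λ x → ε * δ x a) toℕ-last)
      (trans (cong (λ u → ε * u) (δ-refl a)) (*-identityʳ ε)))
    off-last : ∀ j → j ≢ last → cofactorTerm M j ≡ + 0
    off-last j j≢last = trans
      (cong (λ u → neg1^ (toℕ j) * (u * det (a ℕ.+ n) (minor M j)))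
        (trans (top zero j (s≤s z≤n))
          (cong (λ u → ε * u) (δ-≢ (toℕ j) a (λ j≡a → j≢last (toℕ-injective (trans j≡a (sym toℕ-last))))))))
      (vanish (neg1^ (toℕ j)) ε (det (a ℕ.+ n) (minor M j)))
      where
      vanish : ∀ s e x → s * (e * + 0 * x) ≡ + 0
      vanish = solve-∀
    minor-top : ∀ i j → toℕ i ℕ.< a → minor M last i j ≡ ε * δ (suc (toℕ i ℕ.+ toℕ j)) a
    minor-top i j i<a with ℕ.<-≤-connex (toℕ j) a
    ... | inj₁ j<a = trans (top (suc i) (punchIn last j) (s≤s i<a))
      (cong (λ x → ε * δ (suc (toℕ i ℕ.+ x)) a) (toℕ-punchIn-< last j (subst (toℕ j ℕ.<_) (sym toℕ-last) j<a)))
    -- From the deleted column on, both entries lie beyond the antidiagonal, so both deltas are 0.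
    ... | inj₂ a≤j = trans (top (suc i) (punchIn last j) (s≤s i<a))
      (trans (cong (λ x → ε * δ (suc (toℕ i ℕ.+ x)) a) (toℕ-punchIn-≥ last j (subst (ℕ._≤ toℕ j) (sym toℕ-last) a≤j)))
        (cong (λ u → ε * u) (trans (δ-≢ _ a (beyond (suc (toℕ j)) (ℕ.m≤n⇒m≤1+n a≤j)))
                                   (sym (δ-≢ _ a (beyond (toℕ j) a≤j))))))
      where
      beyond : ∀ x → a ℕ.≤ x → suc (toℕ i ℕ.+ x) ≢ a
      beyond x a≤x eq = ℕ.<-irrefl (sym eq) (s≤s (ℕ.≤-trans a≤x (ℕ.m≤n+m x (toℕ i))))
    punchIn-last : ∀ a {n} (j : Fin n) → punchIn (fromℕ a ↑ˡ n) (a ↑ʳ j) ≡ suc a ↑ʳ j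
    punchIn-last zero {suc n} j = refl
    punchIn-last (suc a) j = cong suc (punchIn-last a j)
    reassociate : ∀ s e x y → s * (e * (x * y)) ≡ s * (e * x) * y
    reassociate = solve-∀

  -- Two consecutive expansion signs multiply to -1 and two factors ε to 1, so each pair of rows
  -- contributes -1. Evenness is what makes the result independent of ε.
  antidiagonalDet-even : ε * ε ≡ + 1 → ∀ h → antidiagonalDet ε (h ℕ.+ h) ≡ neg1^ h
  antidiagonalDet-even ε²≡1 zero = refl
  antidiagonalDet-even ε²≡1 (suc h) = begin
    antidiagonalDet ε (suc (h ℕ.+ suc h))     ≡⟨ cong (λ x → antidiagonalDet ε (suc x)) (ℕ.+-suc h h) ⟩
    neg1^ (suc a) * (ε * (neg1^ a * (ε * antidiagonalDet ε a)))
      ≡⟨ regroup (neg1^ (suc a)) (neg1^ a) ε (antidiagonalDet ε a) ⟩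
    neg1^ (suc a) * neg1^ a * (ε * ε * antidiagonalDet ε a)
      ≡⟨ cong₂ (λ x y → x * (y * antidiagonalDet ε a)) (neg1^-consecutive a) ε²≡1 ⟩
    - (+ 1) * (+ 1 * antidiagonalDet ε a)     ≡⟨ cong (λ u → - (+ 1) * u) (*-identityˡ (antidiagonalDet ε a)) ⟩
    - (+ 1) * antidiagonalDet ε a             ≡⟨ cong (λ u → - (+ 1) * u) (antidiagonalDet-even ε²≡1 h) ⟩
    neg1^ (suc h)                             ∎
    where
    a = h ℕ.+ h
    regroup : ∀ x y e z → x * (e * (y * (e * z))) ≡ x * y * (e * e * z)
    regroup = solve-∀

-- Only differences of `ψ` matter, so it may be translated by a bound `K` on all absolute values and
-- becomes natural. This turns an integer potential into a rank fit for `det-reduction`.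
natural-rank : ∀ {n} (ψ : Fin n → ℤ) → ∃ λ (ρ : Fin n → ℕ) → ∀ p v → ψ v ≡ + 1 + ψ p → ρ p ℕ.< ρ v
natural-rank {n} ψ = (λ v → ∣ ψ v + + K ∣) , increasing
  where
  K : ℕ
  K = bound (λ v → ∣ ψ v ∣)
  natural : ∀ x → ∣ x ∣ ℕ.≤ K → ∃ λ t → x + + K ≡ + t
  natural (+ m) _ = m ℕ.+ K , refl
  natural -[1+ m ] m<K = K ℕ.∸ suc m , ⊖-≥ m<K
  increasing : ∀ p v → ψ v ≡ + 1 + ψ p → ∣ ψ p + + K ∣ ℕ.< ∣ ψ v + + K ∣
  increasing p v ψv≡ with natural (ψ p) (ℕ.<⇒≤ (<bound (λ v → ∣ ψ v ∣) p))
  ... | t , eq rewrite ψv≡ | +-assoc (+ 1) (ψ p) (+ K) | eq = ℕ.≤-refl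

-- Reduction of the Hankel matrix

-- Reflection of both blocks {0,…,a−1} and {a+1,…,n−1}, fixing a.
data Reflected (a n : ℕ) : ℕ → ℕ → Set where
  top    : ∀ {v c} → suc (v ℕ.+ c) ≡ a → Reflected a n v c
  middle : Reflected a n a a
  bottom : ∀ {v c} → a ℕ.< v → a ℕ.< c → v ℕ.+ c ≡ a ℕ.+ n → Reflected a n v c

Reflected-sym : ∀ {a n v c} → Reflected a n v c → Reflected a n c v
Reflected-sym {v = v} {c} (top eq) = top (trans (cong suc (ℕ.+-comm c v)) eq)
Reflected-sym middle = middle
Reflected-sym {v = v} {c} (bottom a<v a<c eq) = bottom a<c a<v (trans (ℕ.+-comm c v) eq)

top-< : ∀ {a v c} → suc (v ℕ.+ c) ≡ a → v ℕ.< a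
top-< {v = v} {c} refl = s≤s (ℕ.m≤m+n v c)

Reflected-functional : ∀ {a n v c c′} → Reflected a n v c → Reflected a n v c′ → c ≡ c′
Reflected-functional {v = v} (top eq) (top eq′) = ℕ.+-cancelˡ-≡ (suc v) _ _ (trans eq (sym eq′))
Reflected-functional (top eq) middle = contradiction (top-< eq) (ℕ.<-irrefl refl)
Reflected-functional (top eq) (bottom a<v _ _) = contradiction (top-< eq) (ℕ.<⇒≯ a<v)
Reflected-functional middle (top eq) = contradiction (top-< eq) (ℕ.<-irrefl refl)
Reflected-functional middle middle = refl
Reflected-functional middle (bottom a<a _ _) = contradiction a<a (ℕ.<-irrefl refl)
Reflected-functional (bottom a<v _ _) (top eq) = contradiction (top-< eq) (ℕ.<⇒≯ a<v)
Reflected-functional (bottom a<a _ _) middle = contradiction a<a (ℕ.<-irrefl refl)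
Reflected-functional {v = v} (bottom _ _ eq) (bottom _ _ eq′) = ℕ.+-cancelˡ-≡ v _ _ (trans eq (sym eq′))

reflect : ∀ {a n} → a ℕ.< n → ∀ v → v ℕ.< n → ∃ λ c → c ℕ.< n × Reflected a n v c
reflect {a} {n} a<n v v<n with ℕ.<-cmp v a
... | tri< v<a _ _ = a ℕ.∸ suc v , ℕ.<-trans (ℕ.≤-trans (s≤s (ℕ.m≤n+m (a ℕ.∸ suc v) v)) (ℕ.≤-reflexive eq)) a<n , top eq
  where
  eq : suc (v ℕ.+ (a ℕ.∸ suc v)) ≡ a
  eq = ℕ.m+[n∸m]≡n v<a
... | tri≈ _ refl _ = a , a<n , middle
... | tri> _ _ a<v = c , c<n , bottom a<v a<c eq
  where
  c : ℕ
  c = a ℕ.+ n ℕ.∸ v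
  eq : v ℕ.+ c ≡ a ℕ.+ n
  eq = ℕ.m+[n∸m]≡n (ℕ.≤-trans (ℕ.<⇒≤ v<n) (ℕ.m≤n+m n a))
  c<n : c ℕ.< n
  c<n = ℕ.+-cancelˡ-< a c n (subst (a ℕ.+ c ℕ.<_) eq (ℕ.+-monoˡ-< c a<v))
  a<c : a ℕ.< c
  a<c = ℕ.+-cancelˡ-< n a c (subst (ℕ._< n ℕ.+ c) (ℕ.+-comm a n) (subst (ℕ._< n ℕ.+ c) eq (ℕ.+-monoˡ-< c v<n)))

step : ℕ → ℕ → ℤ
step c j = δ c j - δ (suc c) j

δ-reflect : ∀ v c j → δ (v ℕ.+ j) (v ℕ.+ c) ≡ δ c j
δ-reflect v c j = trans (δ-+ v j c) (δ-sym j c)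

step-reflect : ∀ ε v c j {e} → suc (v ℕ.+ c) ≡ e → ε * (δ (suc (v ℕ.+ j)) e - δ (v ℕ.+ j) e) ≡ ε * step c j
step-reflect ε v c j refl = cong₂ (λ x y → ε * (x - y)) (δ-reflect v c j)
  (trans (cong (δ (v ℕ.+ j)) (sym (ℕ.+-suc v c))) (δ-reflect v (suc c) j))

prefixSum : (ℕ → ℤ) → ℕ → ℤ
prefixSum f zero = + 0
prefixSum f (suc c) = prefixSum f c + f c

neg1^-+ : ∀ x y → neg1^ (x ℕ.+ y) ≡ neg1^ x * neg1^ y
neg1^-+ zero y = sym (*-identityˡ (neg1^ y))
neg1^-+ (suc x) y = trans (cong (λ u → - (+ 1) * u) (neg1^-+ x y)) (sym (*-assoc (- (+ 1)) (neg1^ x) (neg1^ y)))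

-- Abstract form for any sequence `g`: 2h + 1 and 2h′ + 1 stand for |w| and |wuw|. The names of the
-- hypotheses refer to the block of rows served, not to the distance: `short-shift` pairs each of
-- the 2h rows above the root with the row |wuw| further down, `long-shift` each of the 2h′ rows
-- below it with the row |w| further up.
module HankelDeterminant
  (h h′ : ℕ) (ε : ℤ) (ε²≡1 : ε * ε ≡ + 1) (g : ℕ → ℤ)
  (short-shift : ∀ i j → i ℕ.< h ℕ.+ h → j ℕ.< h ℕ.+ h ℕ.+ suc (h′ ℕ.+ h′ ℕ.+ 0) →
    g (i ℕ.+ j) - g (i ℕ.+ suc (h′ ℕ.+ h′) ℕ.+ j)
      ≡ ε * (δ (suc (i ℕ.+ j)) (h ℕ.+ h) - δ (i ℕ.+ j) (h ℕ.+ h)))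
  (long-shift : ∀ i j → i ℕ.< h′ ℕ.+ h′ → j ℕ.< h ℕ.+ h ℕ.+ suc (h′ ℕ.+ h′ ℕ.+ 0) →
    g (i ℕ.+ suc (h ℕ.+ h) ℕ.+ j) - g (i ℕ.+ j)
      ≡ ε * (δ (suc (i ℕ.+ j)) (h ℕ.+ h ℕ.+ suc (h′ ℕ.+ h′ ℕ.+ 0))
             - δ (i ℕ.+ j) (h ℕ.+ h ℕ.+ suc (h′ ℕ.+ h′ ℕ.+ 0))))
  where

  -- The summand b + 0 makes n unfold the way det-antidiagonal-block peels the three blocks off.
  a b n : ℕ
  a = h ℕ.+ h
  b = h′ ℕ.+ h′
  n = a ℕ.+ suc (b ℕ.+ 0)

  n≡ : n ≡ suc a ℕ.+ b
  n≡ = trans (cong (λ x → a ℕ.+ suc x) (ℕ.+-identityʳ b)) (ℕ.+-suc a b)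

  a<n : a ℕ.< n
  a<n = ℕ.m<m+n a (s≤s z≤n)

  col : Fin n → ℕ
  col v = proj₁ (reflect a<n (toℕ v) (toℕ<n v))

  col<n : ∀ v → col v ℕ.< n
  col<n v = proj₁ (proj₂ (reflect a<n (toℕ v) (toℕ<n v)))

  reflected : ∀ v → Reflected a n (toℕ v) (col v)
  reflected v = proj₂ (proj₂ (reflect a<n (toℕ v) (toℕ<n v)))

  col⁻¹ : ∀ c → c ℕ.< n → Fin n
  col⁻¹ c c<n = fromℕ< (proj₁ (proj₂ (reflect a<n c c<n)))

  col-col⁻¹ : ∀ c (c<n : c ℕ.< n) → col (col⁻¹ c c<n) ≡ c
  col-col⁻¹ c c<n = Reflected-functional (reflected (col⁻¹ c c<n))
    (subst (λ x → Reflected a n x c) (sym (toℕ-fromℕ< _)) (Reflected-sym (proj₂ (proj₂ (reflect a<n c c<n)))))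

  col-injective : ∀ u v → col u ≡ col v → u ≡ v
  col-injective u v eq = toℕ-injective (Reflected-functional (Reflected-sym (reflected u))
    (subst (λ c → Reflected a n c (toℕ v)) (sym eq) (Reflected-sym (reflected v))))

  root : Fin n
  root = fromℕ< a<n

  col-root : col root ≡ a
  col-root = Reflected-functional (reflected root) (subst (λ x → Reflected a n x a) (sym (toℕ-fromℕ< a<n)) middle)

  sum-col : ∀ (f : ℕ → ℤ) c → c ℕ.< n → sum (λ v → f (col v) * δ (col v) c) ≡ f c
  sum-col f c c<n = begin
    sum (λ v → f (col v) * δ (col v) c) ≡⟨ sum-single _ (col⁻¹ c c<n) off ⟩
    f (col (col⁻¹ c c<n)) * δ (col (col⁻¹ c c<n)) c ≡⟨ cong (λ x → f x * δ x c) (col-col⁻¹ c c<n) ⟩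
    f c * δ c c                         ≡⟨ cong (λ u → f c * u) (δ-refl c) ⟩
    f c * + 1                           ≡⟨ *-identityʳ (f c) ⟩
    f c                                 ∎
    where
    off : ∀ v → v ≢ col⁻¹ c c<n → f (col v) * δ (col v) c ≡ + 0
    off v v≢ = trans (cong (λ u → f (col v) * u) (δ-≢ (col v) c
      (λ eq → v≢ (col-injective v (col⁻¹ c c<n) (trans eq (sym (col-col⁻¹ c c<n)))))))
      (*-zeroʳ (f (col v)))

  hankel signedUnits signedSteps : Matrix n n
  hankel i j = g (toℕ i ℕ.+ toℕ j)
  signedUnits v j = ε * δ (col v) (toℕ j)
  signedSteps v j = ε * step (col v) (toℕ j)

  -- There are three antidiagonal blocks, of sizes 2h, 1 and 2h′. Only the middle entry leaves a
  -- factor ε, which later cancels against the one in the coefficient of the root row.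
  det-signedUnits : det n signedUnits ≡ ε * neg1^ (h ℕ.+ h′)
  det-signedUnits = begin
    det n signedUnits
      ≡⟨ det-antidiagonal-block ε a (suc (b ℕ.+ 0)) signedUnits top-rows ⟩
    antidiagonalDet ε a * det (suc (b ℕ.+ 0)) (λ i j → signedUnits (a ↑ʳ i) (a ↑ʳ j))
      ≡⟨ cong (λ u → antidiagonalDet ε a * u)
           (det-antidiagonal-block ε 1 (b ℕ.+ 0) (λ i j → signedUnits (a ↑ʳ i) (a ↑ʳ j)) middle-row) ⟩
    antidiagonalDet ε a * (antidiagonalDet ε 1 * det (b ℕ.+ 0) (λ i j → signedUnits (a ↑ʳ suc i) (a ↑ʳ suc j)))
      ≡⟨ cong (λ u → antidiagonalDet ε a * (antidiagonalDet ε 1 * u))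
           (det-antidiagonal-block ε b 0 (λ i j → signedUnits (a ↑ʳ suc i) (a ↑ʳ suc j)) bottom-rows) ⟩
    antidiagonalDet ε a * (antidiagonalDet ε 1 * (antidiagonalDet ε b * + 1))
      ≡⟨ cong₂ (λ x y → x * (antidiagonalDet ε 1 * (y * + 1))) (antidiagonalDet-even ε ε²≡1 h) (antidiagonalDet-even ε ε²≡1 h′) ⟩
    neg1^ h * (antidiagonalDet ε 1 * (neg1^ h′ * + 1))
      ≡⟨ regroup (neg1^ h) ε (neg1^ h′) ⟩
    ε * (neg1^ h * neg1^ h′)
      ≡⟨ cong (λ u → ε * u) (sym (neg1^-+ h h′)) ⟩
    ε * neg1^ (h ℕ.+ h′) ∎
    where
    regroup : ∀ x e y → x * (+ 1 * (e * + 1) * (y * + 1)) ≡ e * (x * y)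
    regroup = solve-∀
    entry : ∀ v j {x y z} → toℕ v ≡ x → toℕ j ≡ y →
            (∀ {c} → Reflected a n x c → δ c y ≡ z) → signedUnits v j ≡ ε * z
    entry v j refl refl f = cong (λ u → ε * u) (f (reflected v))
    top-rows : ∀ i j → toℕ i ℕ.< a → signedUnits i j ≡ ε * δ (suc (toℕ i ℕ.+ toℕ j)) a
    top-rows i j i<a = entry i j refl refl (λ r → at-top r i<a)
      where
      at-top : ∀ {x c y} → Reflected a n x c → x ℕ.< a → δ c y ≡ δ (suc (x ℕ.+ y)) a
      at-top {x} {c} {y} (top eq) _ = sym (trans (cong (δ (suc (x ℕ.+ y))) (sym eq)) (δ-reflect x c y))
      at-top middle a<a = contradiction a<a (ℕ.<-irrefl refl)
      at-top (bottom a<x _ _) x<a = contradiction x<a (ℕ.<⇒≯ a<x)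
    middle-row : ∀ i j → toℕ i ℕ.< 1 → signedUnits (a ↑ʳ i) (a ↑ʳ j) ≡ ε * δ (toℕ i ℕ.+ toℕ j) 0
    middle-row zero j _ = entry (a ↑ʳ zero) (a ↑ʳ j) (trans (toℕ-↑ʳ a zero) (ℕ.+-identityʳ a)) (toℕ-↑ʳ a j)
      (λ r → trans (cong (λ c → δ c (a ℕ.+ toℕ j)) (trans (Reflected-functional r middle) (sym (ℕ.+-identityʳ a))))
        (trans (δ-+ a 0 (toℕ j)) (δ-sym 0 (toℕ j))))
    middle-row (suc i) j (s≤s ())
    bottom-rows : ∀ i j → toℕ i ℕ.< b → signedUnits (a ↑ʳ suc i) (a ↑ʳ suc j) ≡ ε * δ (suc (toℕ i ℕ.+ toℕ j)) b
    bottom-rows i j i<b = entry (a ↑ʳ suc i) (a ↑ʳ suc j) (toℕ-↑ʳ a (suc i)) (toℕ-↑ʳ a (suc j))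
      (λ {c} r → begin
        δ c (a ℕ.+ suc (toℕ j))
          ≡⟨ cong (λ c → δ c (a ℕ.+ suc (toℕ j))) (Reflected-functional {v = a ℕ.+ suc (toℕ i)} r image) ⟩
        δ (a ℕ.+ suc c′) (a ℕ.+ suc (toℕ j))                 ≡⟨ δ-+ a (suc c′) (suc (toℕ j)) ⟩
        δ c′ (toℕ j)                                         ≡⟨ sym (δ-reflect (toℕ i) c′ (toℕ j)) ⟩
        δ (suc (toℕ i ℕ.+ toℕ j)) (suc (toℕ i ℕ.+ c′))       ≡⟨ cong (δ (suc (toℕ i ℕ.+ toℕ j))) i+c′ ⟩
        δ (suc (toℕ i ℕ.+ toℕ j)) b                          ∎)
      where
      c′ : ℕ
      c′ = b ℕ.∸ suc (toℕ i)
      i+c′ : suc (toℕ i ℕ.+ c′) ≡ b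
      i+c′ = ℕ.m+[n∸m]≡n i<b
      image : Reflected a n (a ℕ.+ suc (toℕ i)) (a ℕ.+ suc c′)
      image = bottom (ℕ.m<m+n a (s≤s z≤n)) (ℕ.m<m+n a (s≤s z≤n)) (begin
        a ℕ.+ suc (toℕ i) ℕ.+ (a ℕ.+ suc c′)   ≡⟨ shuffle a (toℕ i) c′ ⟩
        a ℕ.+ (suc a ℕ.+ suc (toℕ i ℕ.+ c′))   ≡⟨ cong (λ x → a ℕ.+ (suc a ℕ.+ x)) i+c′ ⟩
        a ℕ.+ (suc a ℕ.+ b)                    ≡⟨ cong (a ℕ.+_) (sym n≡) ⟩
        a ℕ.+ n                                ∎)
        where
        shuffle : ∀ x y z → x ℕ.+ suc y ℕ.+ (x ℕ.+ suc z) ≡ x ℕ.+ (suc x ℕ.+ suc (y ℕ.+ z))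
        shuffle = ℕ-solve-∀

  -- The change of rows is unitriangular: a step is its unit minus the unit one column to the right,
  -- which for the last column lies outside the matrix. The rank falls as the column grows, so the
  -- subtracted row always ranks lower.
  det-signedSteps : det n signedSteps ≡ det n signedUnits
  det-signedSteps = det-reduction n (λ v → n ℕ.∸ col v) signedUnits signedSteps reduces
    where
    drop-zero : ∀ e x → e * (x - + 0) ≡ e * x
    drop-zero = solve-∀
    distrib : ∀ e x y → e * (x - y) ≡ e * x - e * y
    distrib = solve-∀
    reduces : Reduces (λ v → n ℕ.∸ col v) signedUnits signedSteps
    reduces v with suc (col v) ℕ.<? n
    ... | yes c+1<n = inj₂ (col⁻¹ (suc (col v)) c+1<n ,
        ℕ.∸-monoʳ-< (subst (col v ℕ.<_) (sym (col-col⁻¹ _ c+1<n)) ℕ.≤-refl) (ℕ.<⇒≤ (col<n (col⁻¹ (suc (col v)) c+1<n))) ,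
        λ j → trans (distrib ε _ _) (cong (λ x → ε * δ (col v) (toℕ j) - ε * δ x (toℕ j)) (sym (col-col⁻¹ _ c+1<n))))
    ... | no c+1≮n = inj₁ (λ j → trans
        (cong (λ u → ε * (δ (col v) (toℕ j) - u)) (δ-≢ (suc (col v)) (toℕ j)
          (λ eq → c+1≮n (subst (ℕ._< n) (sym eq) (toℕ<n j)))))
        (drop-zero ε (δ (col v) (toℕ j))))

  rootSum : ℕ → ℤ
  rootSum = prefixSum (λ c → g (a ℕ.+ c))

  -- Abel summation: a row with entries r_c is the sum of the (r_0 + ... + r_c)(e_c - e_{c+1}). The
  -- factor ε in the coefficients cancels the one in `signedSteps`.
  root-as-steps : ∀ j → sum (λ v → ε * rootSum (suc (col v)) * signedSteps v j) ≡ hankel root j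
  root-as-steps j = begin
    sum (λ v → ε * rootSum (suc (col v)) * signedSteps v j)
      ≡⟨ sum-cong-≗ (λ v → trans (regroup ε (rootSum (suc (col v))) (δ (col v) (toℕ j)) (δ (suc (col v)) (toℕ j)))
           (cong (λ u → u * (rootSum (suc (col v)) * δ (col v) (toℕ j) ) - u * (rootSum (suc (col v)) * δ (suc (col v)) (toℕ j))) ε²≡1)) ⟩
    sum (λ v → + 1 * (rootSum (suc (col v)) * δ (col v) (toℕ j)) - + 1 * (rootSum (suc (col v)) * δ (suc (col v)) (toℕ j)))
      ≡⟨ sum-cong-≗ (λ v → as-linear (rootSum (suc (col v)) * δ (col v) (toℕ j)) (rootSum (suc (col v)) * δ (suc (col v)) (toℕ j))) ⟩
    sum (λ v → + 1 * (rootSum (suc (col v)) * δ (col v) (toℕ j)) + - (+ 1) * (rootSum (suc (col v)) * δ (suc (col v)) (toℕ j)))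
      ≡⟨ sum-linear (+ 1) (- (+ 1)) (λ v → rootSum (suc (col v)) * δ (col v) (toℕ j)) (λ v → rootSum (suc (col v)) * δ (suc (col v)) (toℕ j)) ⟩
    + 1 * sum (λ v → rootSum (suc (col v)) * δ (col v) (toℕ j)) + - (+ 1) * sum (λ v → rootSum (suc (col v)) * δ (suc (col v)) (toℕ j))
      ≡⟨ cong₂ (λ x y → + 1 * x + - (+ 1) * y) (sum-col (λ c → rootSum (suc c)) (toℕ j) (toℕ<n j)) (shifted (toℕ j) (toℕ<n j)) ⟩
    + 1 * (rootSum (toℕ j) + g (a ℕ.+ toℕ j)) + - (+ 1) * rootSum (toℕ j)
      ≡⟨ cancel (rootSum (toℕ j)) (g (a ℕ.+ toℕ j)) ⟩
    g (a ℕ.+ toℕ j)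
      ≡⟨ cong (λ x → g (x ℕ.+ toℕ j)) (sym (toℕ-fromℕ< a<n)) ⟩
    hankel root j ∎
    where
    regroup : ∀ e p x y → e * p * (e * (x - y)) ≡ e * e * (p * x) - e * e * (p * y)
    regroup = solve-∀
    as-linear : ∀ x y → + 1 * x - + 1 * y ≡ + 1 * x + - (+ 1) * y
    as-linear = solve-∀
    cancel : ∀ x y → + 1 * (x + y) + - (+ 1) * x ≡ y
    cancel = solve-∀
    shifted : ∀ j → j ℕ.< n → sum (λ v → rootSum (suc (col v)) * δ (suc (col v)) j) ≡ rootSum j
    shifted zero _ = sum-zero {n} _ (λ v → *-zeroʳ (rootSum (suc (col v))))
    shifted (suc j) j<n = sum-col (λ c → rootSum (suc c)) j (ℕ.<-trans (ℕ.n<1+n j) j<n)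

  -- The functional with weights n − j takes the value ε² = 1 on every signed step ε · step c.
  weight : ℕ → ℤ
  weight j = + (n ℕ.∸ j)

  height : Fin n → ℤ
  height v = ε * sum (λ j → weight (toℕ j) * hankel v j)

  sum-weight : ∀ c → c ℕ.≤ n → sum {n} (λ j → weight (toℕ j) * δ c (toℕ j)) ≡ weight c
  sum-weight c c≤n with c ℕ.<? n
  ... | yes c<n = trans (sum-single _ (fromℕ< c<n) off)
      (trans (cong (λ x → weight x * δ c x) (toℕ-fromℕ< c<n))
        (trans (cong (λ u → weight c * u) (δ-refl c)) (*-identityʳ (weight c))))
    where
    off : ∀ j → j ≢ fromℕ< c<n → weight (toℕ j) * δ c (toℕ j) ≡ + 0
    off j j≢ = trans (cong (λ u → weight (toℕ j) * u) (δ-≢ c (toℕ j)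
      (λ c≡j → j≢ (toℕ-injective (trans (sym c≡j) (sym (toℕ-fromℕ< c<n)))))))
      (*-zeroʳ (weight (toℕ j)))
  -- Here c = n. This value arises from the step at the last column, which is e_{n-1} alone; it
  -- obeys the general formula because the weight at n is 0.
  ... | no c≮n = trans
      (sum-zero {n} _ (λ j → trans (cong (λ u → weight (toℕ j) * u) (δ-≢ c (toℕ j) (λ c≡j → c≮n (subst (ℕ._< n) (sym c≡j) (toℕ<n j)))))
        (*-zeroʳ (weight (toℕ j)))))
      (cong +_ (sym (ℕ.m≤n⇒m∸n≡0 (ℕ.≮⇒≥ c≮n))))

  height-step : ∀ p v → (∀ j → signedSteps v j ≡ hankel v j - hankel p j) → height v ≡ + 1 + height p
  height-step p v eq = begin
    ε * sum (λ j → weight (toℕ j) * hankel v j)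
      ≡⟨ cong (λ u → ε * u) (trans (sum-cong-≗ split) (sum-linear (+ 1) ε (λ j → weight (toℕ j) * hankel p j) Z)) ⟩
    ε * (+ 1 * Y + ε * sum Z)
      ≡⟨ cong (λ u → ε * (+ 1 * Y + ε * u)) sum-Z ⟩
    ε * (+ 1 * Y + ε * (+ 1 * (+ 1 + weight (suc (col v))) + - (+ 1) * weight (suc (col v))))
      ≡⟨ collect ε Y (weight (suc (col v))) ⟩
    ε * ε + ε * Y
      ≡⟨ cong (λ u → u + ε * Y) ε²≡1 ⟩
    + 1 + height p ∎
    where
    Y : ℤ
    Y = sum (λ j → weight (toℕ j) * hankel p j)
    Z : Fin n → ℤ
    Z j = + 1 * (weight (toℕ j) * δ (col v) (toℕ j)) + - (+ 1) * (weight (toℕ j) * δ (suc (col v)) (toℕ j))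
    weight-suc : weight (col v) ≡ + 1 + weight (suc (col v))
    weight-suc = cong +_ (ℕ.+-∸-assoc 1 (col<n v))
    sum-Z : sum Z ≡ + 1 * (+ 1 + weight (suc (col v))) + - (+ 1) * weight (suc (col v))
    sum-Z = begin
      sum Z
        ≡⟨ sum-linear {n} (+ 1) (- (+ 1)) (λ j → weight (toℕ j) * δ (col v) (toℕ j)) (λ j → weight (toℕ j) * δ (suc (col v)) (toℕ j)) ⟩
      + 1 * sum {n} (λ j → weight (toℕ j) * δ (col v) (toℕ j)) + - (+ 1) * sum {n} (λ j → weight (toℕ j) * δ (suc (col v)) (toℕ j))
        ≡⟨ cong₂ (λ x y → + 1 * x + - (+ 1) * y) (trans (sum-weight (col v) (ℕ.<⇒≤ (col<n v))) weight-suc) (sum-weight (suc (col v)) (col<n v)) ⟩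
      + 1 * (+ 1 + weight (suc (col v))) + - (+ 1) * weight (suc (col v)) ∎
    collect : ∀ e y w → e * (+ 1 * y + e * (+ 1 * (+ 1 + w) + - (+ 1) * w)) ≡ e * e + e * y
    collect = solve-∀
    regroup : ∀ w x e s t → w * (x + e * (s - t)) ≡ + 1 * (w * x) + e * (+ 1 * (w * s) + - (+ 1) * (w * t))
    regroup = solve-∀
    restore : ∀ x y → x ≡ y + (x - y)
    restore = solve-∀
    split : ∀ j → weight (toℕ j) * hankel v j ≡ + 1 * (weight (toℕ j) * hankel p j)
              + ε * (+ 1 * (weight (toℕ j) * δ (col v) (toℕ j)) + - (+ 1) * (weight (toℕ j) * δ (suc (col v)) (toℕ j)))
    split j = trans (cong (λ u → weight (toℕ j) * u)
        (trans (restore (hankel v j) (hankel p j)) (cong (λ u → hankel p j + u) (sym (eq j)))))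
      (regroup (weight (toℕ j)) (hankel p j) ε (δ (col v) (toℕ j)) (δ (suc (col v)) (toℕ j)))

  -- Both blocks follow one rule, v ↦ v - (a + 1) modulo n + 1 = (a + 1) + (b + 1). Only v = a would
  -- be sent to n, which is not a row; this singles out the root.
  parent : ∀ v → v ≡ root ⊎ ∃ λ p → ∀ j → signedSteps v j ≡ hankel v j - hankel p j
  parent v = by-cases (toℕ<n v) refl (reflected v)
    where
    by-cases : ∀ {x c} → x ℕ.< n → toℕ v ≡ x → Reflected a n x c →
               v ≡ root ⊎ ∃ λ p → ∀ j → ε * step c (toℕ j) ≡ hankel v j - hankel p j
    by-cases {x} {c} _ v≡x (top eq) = inj₂ (fromℕ< p<n , λ j → sym (begin
      g (toℕ v ℕ.+ toℕ j) - g (toℕ (fromℕ< p<n) ℕ.+ toℕ j)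
        ≡⟨ cong₂ (λ y z → g (y ℕ.+ toℕ j) - g (z ℕ.+ toℕ j)) v≡x (toℕ-fromℕ< p<n) ⟩
      g (x ℕ.+ toℕ j) - g (x ℕ.+ suc b ℕ.+ toℕ j)
        ≡⟨ short-shift x (toℕ j) (top-< eq) (toℕ<n j) ⟩
      ε * (δ (suc (x ℕ.+ toℕ j)) a - δ (x ℕ.+ toℕ j) a)
        ≡⟨ step-reflect ε x c (toℕ j) eq ⟩
      ε * step c (toℕ j) ∎))
      where
      p<n : x ℕ.+ suc b ℕ.< n
      p<n = subst (λ y → x ℕ.+ suc b ℕ.< a ℕ.+ suc y) (sym (ℕ.+-identityʳ b)) (ℕ.+-monoˡ-< (suc b) (top-< eq))
    by-cases _ v≡a middle = inj₁ (toℕ-injective (trans v≡a (sym (toℕ-fromℕ< a<n))))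
    by-cases {x} {c} x<n v≡x (bottom a<x _ eq) = inj₂ (fromℕ< i<n , λ j → sym (begin
      g (toℕ v ℕ.+ toℕ j) - g (toℕ (fromℕ< i<n) ℕ.+ toℕ j)
        ≡⟨ cong₂ (λ y z → g (y ℕ.+ toℕ j) - g (z ℕ.+ toℕ j)) (trans v≡x (sym i+)) (toℕ-fromℕ< i<n) ⟩
      g (i ℕ.+ suc a ℕ.+ toℕ j) - g (i ℕ.+ toℕ j)
        ≡⟨ long-shift i (toℕ j) i<b (toℕ<n j) ⟩
      ε * (δ (suc (i ℕ.+ toℕ j)) n - δ (i ℕ.+ toℕ j) n)
        ≡⟨ step-reflect ε i c (toℕ j) i-eq ⟩
      ε * step c (toℕ j) ∎))
      where
      i : ℕ
      i = x ℕ.∸ suc a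
      i+ : i ℕ.+ suc a ≡ x
      i+ = ℕ.m∸n+n≡m a<x
      i<b : i ℕ.< b
      i<b = ℕ.+-cancelʳ-< (suc a) i b (subst₂ ℕ._<_ (sym i+) (trans n≡ (ℕ.+-comm (suc a) b)) x<n)
      i<n : i ℕ.< n
      i<n = ℕ.≤-<-trans (ℕ.m∸n≤m x (suc a)) x<n
      i-eq : suc (i ℕ.+ c) ≡ n
      i-eq = ℕ.+-cancelˡ-≡ a _ _ (begin
        a ℕ.+ suc (i ℕ.+ c)   ≡⟨ ℕ.+-suc a (i ℕ.+ c) ⟩
        suc (a ℕ.+ (i ℕ.+ c)) ≡⟨ sym (ℕ.+-assoc (suc a) i c) ⟩
        suc a ℕ.+ i ℕ.+ c     ≡⟨ cong (ℕ._+ c) (trans (ℕ.+-comm (suc a) i) i+) ⟩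
        x ℕ.+ c               ≡⟨ eq ⟩
        a ℕ.+ n               ∎)

  reduced : Matrix n n
  reduced = signedSteps [ root ≔ hankel root ]

  det-reduced : det n reduced ≡ ε * rootSum (suc a) * det n signedSteps
  det-reduced = begin
    det n reduced ≡⟨ det-cong n (update-cong signedSteps root (λ j → sym (root-as-steps j))) ⟩
    det n (signedSteps [ root ≔ (λ j → sum (λ v → ε * rootSum (suc (col v)) * signedSteps v j)) ])
      ≡⟨ det-update-combination n signedSteps root (λ v → ε * rootSum (suc (col v))) ⟩
    ε * rootSum (suc (col root)) * det n signedSteps
      ≡⟨ cong (λ c → ε * rootSum (suc c) * det n signedSteps) col-root ⟩
    ε * rootSum (suc a) * det n signedSteps ∎

  det-hankel-reduced : det n reduced ≡ det n hankel
  det-hankel-reduced = det-reduction n (proj₁ rank) hankel reduced reduces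
    where
    rank = natural-rank height
    reduces : Reduces (proj₁ rank) hankel reduced
    reduces v with v ≟ root
    ... | yes refl = inj₁ (updated-row signedSteps root (hankel root))
    ... | no v≢root with parent v
    ...   | inj₁ v≡root = contradiction v≡root v≢root
    ...   | inj₂ (p , eq) = inj₂ (p , proj₂ rank p v (height-step p v eq) ,
              λ j → trans (other-row signedSteps root (hankel root) v v≢root j) (eq j))

  det-hankel : det n hankel ≡ neg1^ (h ℕ.+ h′) * rootSum (suc a)
  det-hankel = begin
    det n hankel                                              ≡⟨ sym det-hankel-reduced ⟩
    det n reduced                                             ≡⟨ det-reduced ⟩
    ε * rootSum (suc a) * det n signedSteps                 ≡⟨ cong (λ u → ε * rootSum (suc a) * u) (trans det-signedSteps det-signedUnits) ⟩
    ε * rootSum (suc a) * (ε * neg1^ (h ℕ.+ h′))            ≡⟨ regroup ε (rootSum (suc a)) (neg1^ (h ℕ.+ h′)) ⟩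
    ε * ε * (neg1^ (h ℕ.+ h′) * rootSum (suc a))            ≡⟨ cong (λ u → u * (neg1^ (h ℕ.+ h′) * rootSum (suc a))) ε²≡1 ⟩
    + 1 * (neg1^ (h ℕ.+ h′) * rootSum (suc a))              ≡⟨ *-identityˡ _ ⟩
    neg1^ (h ℕ.+ h′) * rootSum (suc a)                      ∎
    where
    regroup : ∀ e p s → e * p * (e * s) ≡ e * e * (s * p)
    regroup = solve-∀

-- The fixed point of τ

at-++ˡ : ∀ xs ys q → q ℕ.< length xs → at (xs ++ ys) q ≡ at xs q
at-++ˡ (x ∷ xs) ys zero _ = refl
at-++ˡ (x ∷ xs) ys (suc q) (s≤s q<) = at-++ˡ xs ys q q<

at-++ʳ : ∀ xs ys q → at (xs ++ ys) (length xs ℕ.+ q) ≡ at ys q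
at-++ʳ [] ys q = refl
at-++ʳ (x ∷ xs) ys q = at-++ʳ xs ys q

-- The places compared end with `Z`. The tails are left independent because two shifted copies of
-- the fixed point disagree again further on.
swap-difference : ∀ L x y Z T₁ T₂ q → q ℕ.< length L ℕ.+ (2 ℕ.+ length Z) →
  + at (L ++ y ∷ x ∷ Z ++ T₁) q - + at (L ++ x ∷ y ∷ Z ++ T₂) q
    ≡ (+ y - + x) * (δ q (length L) - δ q (suc (length L)))
swap-difference [] x y Z T₁ T₂ 0 _ = at-first (+ y) (+ x)
  where
  at-first : ∀ y x → y - x ≡ (y - x) * (+ 1 - + 0)
  at-first = solve-∀
swap-difference [] x y Z T₁ T₂ 1 _ = at-second (+ y) (+ x)
  where
  at-second : ∀ y x → x - y ≡ (y - x) * (+ 0 - + 1)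
  at-second = solve-∀
swap-difference [] x y Z T₁ T₂ (suc (suc q)) (s≤s (s≤s q<)) = trans
  (cong₂ (λ u v → + u - + v) (at-++ˡ Z T₁ q q<) (at-++ˡ Z T₂ q q<)) (unchanged (+ y) (+ x) (+ at Z q))
  where
  unchanged : ∀ y x z → z - z ≡ (y - x) * (+ 0 - + 0)
  unchanged = solve-∀
swap-difference (z ∷ L) x y Z T₁ T₂ zero _ = unchanged (+ y) (+ x) (+ z)
  where
  unchanged : ∀ y x z → z - z ≡ (y - x) * (+ 0 - + 0)
  unchanged = solve-∀
swap-difference (z ∷ L) x y Z T₁ T₂ (suc q) (s≤s q<) = swap-difference L x y Z T₁ T₂ q q<

prefixSum-cong : ∀ {f f′} t → (∀ c → c ℕ.< t → f c ≡ f′ c) → prefixSum f t ≡ prefixSum f′ t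
prefixSum-cong zero eq = refl
prefixSum-cong (suc t) eq = cong₂ _+_ (prefixSum-cong t (λ c c<t → eq c (ℕ.m<n⇒m<1+n c<t))) (eq t ℕ.≤-refl)

prefixSum-cons : ∀ f t → prefixSum f (suc t) ≡ f 0 + prefixSum (λ c → f (suc c)) t
prefixSum-cons f zero = trans (+-identityˡ (f 0)) (sym (+-identityʳ (f 0)))
prefixSum-cons f (suc t) = trans (cong (λ u → u + f (suc t)) (prefixSum-cons f t))
  (+-assoc (f 0) (prefixSum (λ c → f (suc c)) t) (f (suc t)))

prefixSum-at : ∀ xs → prefixSum (λ c → + at xs c) (length xs) ≡ + total xs
prefixSum-at [] = refl
prefixSum-at (x ∷ xs) = trans (prefixSum-cons (λ c → + at (x ∷ xs) c) (length xs)) (cong (λ u → + x + u) (prefixSum-at xs))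

-- To be read with `b` = w, `c` = u and `a` = wuw; `l` and `r` surround the two letters in which wu
-- and uw differ. As variables these words are atoms for the monoid solver.
module Window
  (a b c l r : List ℕ) (x y : ℕ) (h h′ : ℕ)
  (a≡ : a ≡ b ++ c ++ b)
  (bc≡ : b ++ c ≡ l ++ x ∷ y ∷ r) (cb≡ : c ++ b ≡ l ++ y ∷ x ∷ r)
  (ε²≡1 : (+ y - + x) * (+ y - + x) ≡ + 1)
  (|b|≡ : length b ≡ suc (h ℕ.+ h)) (|a|≡ : length a ≡ suc (h′ ℕ.+ h′))
  (l≡ : suc (length l) ≡ total b)
  (b+c : length b ℕ.+ length c ≡ total b ℕ.+ total b)
  (total-bc : total b ℕ.+ total c ≡ length b)
  (c≤b : length c ℕ.≤ length b)
  -- The tail `T` may vary with `q`: in this form the prefix property needs no case split on whether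
  -- `q` lies inside the displayed word.
  (s-prefix : ∀ q → ∃ λ T → s q ≡ at ((a ++ b ++ a ++ a ++ a ++ b ++ a) ++ T) q)
  where

  N m n : ℕ
  N = total b
  m = N ℕ.+ 1
  n = h ℕ.+ h ℕ.+ suc (h′ ℕ.+ h′ ℕ.+ 0)

  ε : ℤ
  ε = + y - + x

  g : ℕ → ℤ
  g z = + s (m ℕ.+ z)

  xy yx : List ℕ
  xy = x ∷ y ∷ []
  yx = y ∷ x ∷ []

  L₁ Z₁ L₂ Z₂ : List ℕ
  L₁ = b ++ l
  Z₁ = r ++ b ++ a ++ a
  L₂ = r ++ b ++ b ++ l
  Z₂ = r ++ b ++ l

  -- Read from place 0 the fixed point begins b·cb·b·a·a, read from place |a| it begins b·bc·b·a·a.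
  -- The common parts before and after the swap are `L₁` and `Z₁`.
  prefix-short : ∀ T → (a ++ b ++ a ++ a ++ a ++ b ++ a) ++ T ≡ L₁ ++ yx ++ (Z₁ ++ a ++ b ++ a ++ T)
  prefix-short T = begin
    (a ++ b ++ a ++ a ++ a ++ b ++ a) ++ T
      ≡⟨ cong (λ u → (u ++ b ++ a ++ a ++ a ++ b ++ a) ++ T) a≡ ⟩
    ((b ++ c ++ b) ++ b ++ a ++ a ++ a ++ b ++ a) ++ T
      ≡⟨ solve (++-monoid ℕ) ⟩
    b ++ (c ++ b) ++ b ++ a ++ a ++ a ++ b ++ a ++ T
      ≡⟨ cong (λ u → b ++ u ++ b ++ a ++ a ++ a ++ b ++ a ++ T) cb≡ ⟩
    b ++ (l ++ yx ++ r) ++ b ++ a ++ a ++ a ++ b ++ a ++ T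
      ≡⟨ regroup yx ⟩
    L₁ ++ yx ++ (Z₁ ++ a ++ b ++ a ++ T) ∎
    where
    regroup : ∀ w → b ++ (l ++ w ++ r) ++ b ++ a ++ a ++ a ++ b ++ a ++ T ≡ (b ++ l) ++ w ++ ((r ++ b ++ a ++ a) ++ a ++ b ++ a ++ T)
    regroup w = solve (++-monoid ℕ)

  prefix-short-shifted : ∀ T → (a ++ b ++ a ++ a ++ a ++ b ++ a) ++ T ≡ a ++ (L₁ ++ xy ++ (Z₁ ++ b ++ a ++ T))
  prefix-short-shifted T = begin
    (a ++ b ++ a ++ a ++ a ++ b ++ a) ++ T
      ≡⟨ cong (λ u → (a ++ b ++ u ++ a ++ a ++ b ++ a) ++ T) a≡ ⟩
    (a ++ b ++ (b ++ c ++ b) ++ a ++ a ++ b ++ a) ++ T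
      ≡⟨ solve (++-monoid ℕ) ⟩
    a ++ b ++ (b ++ c) ++ b ++ a ++ a ++ b ++ a ++ T
      ≡⟨ cong (λ u → a ++ b ++ u ++ b ++ a ++ a ++ b ++ a ++ T) bc≡ ⟩
    a ++ b ++ (l ++ xy ++ r) ++ b ++ a ++ a ++ b ++ a ++ T
      ≡⟨ regroup xy ⟩
    a ++ (L₁ ++ xy ++ (Z₁ ++ b ++ a ++ T)) ∎
    where
    regroup : ∀ w → a ++ b ++ (l ++ w ++ r) ++ b ++ a ++ a ++ b ++ a ++ T ≡ a ++ ((b ++ l) ++ w ++ ((r ++ b ++ a ++ a) ++ b ++ a ++ T))
    regroup w = solve (++-monoid ℕ)

  -- Up to the third swap, the shift by |b| shows the same word with every xy turned into yx.
  -- Cutting off l·x·y, of length `m`, removes the first swap; `L₂` then leads to the second and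
  -- `Z₂` from there to the third.
  prefix-long : ∀ T → (a ++ b ++ a ++ a ++ a ++ b ++ a) ++ T
                ≡ (l ++ xy) ++ (L₂ ++ xy ++ (Z₂ ++ xy ++ r ++ b ++ a ++ b ++ a ++ T))
  prefix-long T = begin
    (a ++ b ++ a ++ a ++ a ++ b ++ a) ++ T
      ≡⟨ cong (λ u → (u ++ b ++ u ++ u ++ a ++ b ++ a) ++ T) a≡ ⟩
    ((b ++ c ++ b) ++ b ++ (b ++ c ++ b) ++ (b ++ c ++ b) ++ a ++ b ++ a) ++ T
      ≡⟨ solve (++-monoid ℕ) ⟩
    (b ++ c) ++ b ++ b ++ (b ++ c) ++ b ++ (b ++ c) ++ b ++ a ++ b ++ a ++ T
      ≡⟨ cong (λ u → u ++ b ++ b ++ u ++ b ++ u ++ b ++ a ++ b ++ a ++ T) bc≡ ⟩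
    (l ++ xy ++ r) ++ b ++ b ++ (l ++ xy ++ r) ++ b ++ (l ++ xy ++ r) ++ b ++ a ++ b ++ a ++ T
      ≡⟨ regroup xy ⟩
    (l ++ xy) ++ (L₂ ++ xy ++ (Z₂ ++ xy ++ r ++ b ++ a ++ b ++ a ++ T)) ∎
    where
    regroup : ∀ w → (l ++ w ++ r) ++ b ++ b ++ (l ++ w ++ r) ++ b ++ (l ++ w ++ r) ++ b ++ a ++ b ++ a ++ T
      ≡ (l ++ w) ++ ((r ++ b ++ b ++ l) ++ w ++ ((r ++ b ++ l) ++ w ++ r ++ b ++ a ++ b ++ a ++ T))
    regroup w = solve (++-monoid ℕ)

  prefix-long-shifted : ∀ T → (a ++ b ++ a ++ a ++ a ++ b ++ a) ++ T
                        ≡ b ++ ((l ++ yx) ++ (L₂ ++ yx ++ (Z₂ ++ yx ++ r ++ a ++ b ++ a ++ T)))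
  prefix-long-shifted T = begin
    (a ++ b ++ a ++ a ++ a ++ b ++ a) ++ T
      ≡⟨ cong (λ u → (u ++ b ++ u ++ u ++ a ++ b ++ a) ++ T) a≡ ⟩
    ((b ++ c ++ b) ++ b ++ (b ++ c ++ b) ++ (b ++ c ++ b) ++ a ++ b ++ a) ++ T
      ≡⟨ solve (++-monoid ℕ) ⟩
    b ++ (c ++ b) ++ b ++ b ++ (c ++ b) ++ b ++ (c ++ b) ++ a ++ b ++ a ++ T
      ≡⟨ cong (λ u → b ++ u ++ b ++ b ++ u ++ b ++ u ++ a ++ b ++ a ++ T) cb≡ ⟩
    b ++ (l ++ yx ++ r) ++ b ++ b ++ (l ++ yx ++ r) ++ b ++ (l ++ yx ++ r) ++ a ++ b ++ a ++ T
      ≡⟨ regroup yx ⟩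
    b ++ ((l ++ yx) ++ (L₂ ++ yx ++ (Z₂ ++ yx ++ r ++ a ++ b ++ a ++ T))) ∎
    where
    regroup : ∀ w → b ++ (l ++ w ++ r) ++ b ++ b ++ (l ++ w ++ r) ++ b ++ (l ++ w ++ r) ++ a ++ b ++ a ++ T
      ≡ b ++ ((l ++ w) ++ ((r ++ b ++ b ++ l) ++ w ++ ((r ++ b ++ l) ++ w ++ r ++ a ++ b ++ a ++ T)))
    regroup w = solve (++-monoid ℕ)

  |l|+1 : length l ℕ.+ 1 ≡ N
  |l|+1 = trans (ℕ.+-comm (length l) 1) l≡

  |l++xy| : ∀ u v → length (l ++ u ∷ v ∷ []) ≡ m
  |l++xy| u v = trans (length-++ l) (trans (sym (ℕ.+-assoc (length l) 1 1)) (cong (ℕ._+ 1) |l|+1))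

  |bc| : length b ℕ.+ length c ≡ length l ℕ.+ (2 ℕ.+ length r)
  |bc| = trans (sym (length-++ b)) (trans (cong length bc≡) (length-++ l))

  |a|-split : length a ≡ length b ℕ.+ (length c ℕ.+ length b)
  |a|-split = trans (cong length a≡) (trans (length-++ b) (cong (length b ℕ.+_) (length-++ c)))

  n≡a+b : suc n ≡ length b ℕ.+ length a
  n≡a+b = begin
    suc (h ℕ.+ h) ℕ.+ suc (h′ ℕ.+ h′ ℕ.+ 0)  ≡⟨ cong (λ z → suc (h ℕ.+ h) ℕ.+ suc z) (ℕ.+-identityʳ (h′ ℕ.+ h′)) ⟩
    suc (h ℕ.+ h) ℕ.+ suc (h′ ℕ.+ h′)        ≡⟨ sym (cong₂ ℕ._+_ |b|≡ |a|≡) ⟩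
    length b ℕ.+ length a                    ∎

  short-shift : ∀ i j → i ℕ.< h ℕ.+ h → j ℕ.< n →
    g (i ℕ.+ j) - g (i ℕ.+ suc (h′ ℕ.+ h′) ℕ.+ j) ≡ ε * (δ (suc (i ℕ.+ j)) (h ℕ.+ h) - δ (i ℕ.+ j) (h ℕ.+ h))
  short-shift i j i<a j<n = begin
    g z - g (i ℕ.+ suc (h′ ℕ.+ h′) ℕ.+ j)
      ≡⟨ cong (λ w → g z - + s w) index ⟩
    g z - + s (length a ℕ.+ q)
      ≡⟨ cong₂ (λ u v → + u - + v) (proj₂ first) (proj₂ second) ⟩
    + at (L₁ ++ y ∷ x ∷ Z₁ ++ proj₁ first) q - + at (L₁ ++ x ∷ y ∷ Z₁ ++ proj₁ second) q
      ≡⟨ swap-difference L₁ x y Z₁ (proj₁ first) (proj₁ second) q q< ⟩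
    ε * (δ q (length L₁) - δ q (suc (length L₁)))
      ≡⟨ cong₂ (λ u v → ε * (u - v)) δ₁ δ₂ ⟩
    ε * (δ (suc z) (h ℕ.+ h) - δ z (h ℕ.+ h)) ∎
    where
    z q : ℕ
    z = i ℕ.+ j
    q = m ℕ.+ z
    index : m ℕ.+ (i ℕ.+ suc (h′ ℕ.+ h′) ℕ.+ j) ≡ length a ℕ.+ q
    index = trans (shuffle m i (suc (h′ ℕ.+ h′)) j) (cong (ℕ._+ q) (sym |a|≡))
      where
      shuffle : ∀ m i a j → m ℕ.+ (i ℕ.+ a ℕ.+ j) ≡ a ℕ.+ (m ℕ.+ (i ℕ.+ j))
      shuffle = ℕ-solve-∀
    first : ∃ λ W → s q ≡ at (L₁ ++ y ∷ x ∷ Z₁ ++ W) q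
    first with s-prefix q
    ... | T , eq = a ++ b ++ a ++ T , trans eq (cong (λ t → at t q) (prefix-short T))
    second : ∃ λ W → s (length a ℕ.+ q) ≡ at (L₁ ++ x ∷ y ∷ Z₁ ++ W) q
    second with s-prefix (length a ℕ.+ q)
    ... | T , eq = b ++ a ++ T , trans eq (trans (cong (λ t → at t (length a ℕ.+ q)) (prefix-short-shifted T)) (at-++ʳ a _ q))
    |L₁| : length L₁ ≡ h ℕ.+ h ℕ.+ N
    |L₁| = begin
      length (b ++ l)                     ≡⟨ length-++ b ⟩
      length b ℕ.+ length l               ≡⟨ cong (ℕ._+ length l) |b|≡ ⟩
      suc (h ℕ.+ h) ℕ.+ length l          ≡⟨ sym (ℕ.+-suc (h ℕ.+ h) (length l)) ⟩
      h ℕ.+ h ℕ.+ suc (length l)          ≡⟨ cong (h ℕ.+ h ℕ.+_) l≡ ⟩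
      h ℕ.+ h ℕ.+ N                       ∎
    δ₁ : δ q (length L₁) ≡ δ (suc z) (h ℕ.+ h)
    δ₁ = trans (cong₂ δ (ℕ.+-assoc N 1 z) (trans |L₁| (ℕ.+-comm (h ℕ.+ h) N))) (δ-+ N (suc z) (h ℕ.+ h))
    δ₂ : δ q (suc (length L₁)) ≡ δ z (h ℕ.+ h)
    δ₂ = trans (cong₂ δ (ℕ.+-assoc N 1 z) (trans (cong suc (trans |L₁| (ℕ.+-comm (h ℕ.+ h) N))) (sym (ℕ.+-suc N (h ℕ.+ h)))))
      (δ-+ N (suc z) (suc (h ℕ.+ h)))
    q< : q ℕ.< length L₁ ℕ.+ (2 ℕ.+ length Z₁)
    -- A coarse bound suffices: `q` stays below N + 2|b| + |a|, hence below 3|b| + |a|, which lies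
    -- within the common part.
    q< = ℕ.≤-trans (ℕ.≤-trans (ℕ.n≤1+n (suc q)) z-bound)
      (ℕ.≤-trans (ℕ.≤-reflexive lower)
        (ℕ.≤-trans (ℕ.+-monoˡ-≤ _ (subst (N ℕ.≤_) total-bc (ℕ.m≤m+n N (total c))))
          (ℕ.≤-trans (ℕ.m≤m+n _ (length c ℕ.+ length a)) (ℕ.≤-reflexive upper))))
      where
      z-bound : suc (suc (m ℕ.+ z)) ℕ.≤ suc (m ℕ.+ (h ℕ.+ h ℕ.+ n))
      z-bound = s≤s (subst (ℕ._≤ m ℕ.+ (h ℕ.+ h ℕ.+ n)) (ℕ.+-suc m z) (ℕ.+-monoʳ-≤ m (ℕ.+-mono-< i<a j<n)))
      shuffle₁ : ∀ N a n → suc (N ℕ.+ 1 ℕ.+ (a ℕ.+ n)) ≡ N ℕ.+ (suc a ℕ.+ suc n)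
      shuffle₁ = ℕ-solve-∀
      lower : suc (m ℕ.+ (h ℕ.+ h ℕ.+ n)) ≡ N ℕ.+ (length b ℕ.+ (length b ℕ.+ length a))
      lower = trans (shuffle₁ N (h ℕ.+ h) n) (cong₂ (λ u v → N ℕ.+ (u ℕ.+ v)) (sym |b|≡) n≡a+b)
      shuffle₂ : ∀ b c a → b ℕ.+ (b ℕ.+ (b ℕ.+ a)) ℕ.+ (c ℕ.+ a) ≡ b ℕ.+ (b ℕ.+ c ℕ.+ (b ℕ.+ (a ℕ.+ a)))
      shuffle₂ = ℕ-solve-∀
      shuffle₃ : ∀ b l r a → b ℕ.+ (l ℕ.+ (2 ℕ.+ r) ℕ.+ (b ℕ.+ (a ℕ.+ a))) ≡ b ℕ.+ l ℕ.+ (2 ℕ.+ (r ℕ.+ (b ℕ.+ (a ℕ.+ a))))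
      shuffle₃ = ℕ-solve-∀
      upper : length b ℕ.+ (length b ℕ.+ (length b ℕ.+ length a)) ℕ.+ (length c ℕ.+ length a) ≡ length L₁ ℕ.+ (2 ℕ.+ length Z₁)
      upper = begin
        length b ℕ.+ (length b ℕ.+ (length b ℕ.+ length a)) ℕ.+ (length c ℕ.+ length a)
          ≡⟨ shuffle₂ (length b) (length c) (length a) ⟩
        length b ℕ.+ (length b ℕ.+ length c ℕ.+ (length b ℕ.+ (length a ℕ.+ length a)))
          ≡⟨ cong (λ w → length b ℕ.+ (w ℕ.+ (length b ℕ.+ (length a ℕ.+ length a)))) |bc| ⟩
        length b ℕ.+ (length l ℕ.+ (2 ℕ.+ length r) ℕ.+ (length b ℕ.+ (length a ℕ.+ length a)))
          ≡⟨ shuffle₃ (length b) (length l) (length r) (length a) ⟩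
        length b ℕ.+ length l ℕ.+ (2 ℕ.+ (length r ℕ.+ (length b ℕ.+ (length a ℕ.+ length a))))
          ≡⟨ sym (cong₂ (λ u v → u ℕ.+ (2 ℕ.+ v)) (length-++ b)
               (trans (length-++ r) (cong (length r ℕ.+_) (trans (length-++ b) (cong (length b ℕ.+_) (length-++ a)))))) ⟩
        length L₁ ℕ.+ (2 ℕ.+ length Z₁) ∎

  long-shift : ∀ i j → i ℕ.< h′ ℕ.+ h′ → j ℕ.< n →
    g (i ℕ.+ suc (h ℕ.+ h) ℕ.+ j) - g (i ℕ.+ j) ≡ ε * (δ (suc (i ℕ.+ j)) n - δ (i ℕ.+ j) n)
  long-shift i j i<b j<n = begin
    g (i ℕ.+ suc (h ℕ.+ h) ℕ.+ j) - g z
      ≡⟨ cong₂ (λ u v → + s u - + s v) index (cong (ℕ._+ z) (sym (|l++xy| x y))) ⟩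
    + s (length b ℕ.+ (length (l ++ yx) ℕ.+ z)) - + s (length (l ++ xy) ℕ.+ z)
      ≡⟨ cong₂ (λ u v → + u - + v) (proj₂ first) (proj₂ second) ⟩
    + at (L₂ ++ y ∷ x ∷ Z₂ ++ proj₁ first) z - + at (L₂ ++ x ∷ y ∷ Z₂ ++ proj₁ second) z
      ≡⟨ swap-difference L₂ x y Z₂ (proj₁ first) (proj₁ second) z z< ⟩
    ε * (δ z (length L₂) - δ z (suc (length L₂)))
      ≡⟨ cong (λ w → ε * (δ (suc z) w - δ z w)) (sym n≡) ⟩
    ε * (δ (suc z) n - δ z n) ∎
    where
    z : ℕ
    z = i ℕ.+ j
    index : m ℕ.+ (i ℕ.+ suc (h ℕ.+ h) ℕ.+ j) ≡ length b ℕ.+ (length (l ++ yx) ℕ.+ z)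
    index = trans (shuffle m i (suc (h ℕ.+ h)) j) (cong₂ (λ u v → u ℕ.+ (v ℕ.+ z)) (sym |b|≡) (sym (|l++xy| y x)))
      where
      shuffle : ∀ m i a j → m ℕ.+ (i ℕ.+ a ℕ.+ j) ≡ a ℕ.+ (m ℕ.+ (i ℕ.+ j))
      shuffle = ℕ-solve-∀
    first : ∃ λ W → s (length b ℕ.+ (length (l ++ yx) ℕ.+ z)) ≡ at (L₂ ++ y ∷ x ∷ Z₂ ++ W) z
    first with s-prefix (length b ℕ.+ (length (l ++ yx) ℕ.+ z))
    ... | T , eq = yx ++ r ++ a ++ b ++ a ++ T ,
      trans eq (trans (cong (λ t → at t (length b ℕ.+ (length (l ++ yx) ℕ.+ z))) (prefix-long-shifted T))
        (trans (at-++ʳ b _ _) (at-++ʳ (l ++ yx) _ z)))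
    second : ∃ λ W → s (length (l ++ xy) ℕ.+ z) ≡ at (L₂ ++ x ∷ y ∷ Z₂ ++ W) z
    second with s-prefix (length (l ++ xy) ℕ.+ z)
    ... | T , eq = xy ++ r ++ b ++ a ++ b ++ a ++ T ,
      trans eq (trans (cong (λ t → at t (length (l ++ xy) ℕ.+ z)) (prefix-long T)) (at-++ʳ (l ++ xy) _ z))
    |L₂| : length L₂ ≡ length r ℕ.+ (length b ℕ.+ (length b ℕ.+ length l))
    |L₂| = trans (length-++ r) (cong (length r ℕ.+_) (trans (length-++ b) (cong (length b ℕ.+_) (length-++ b))))
    n≡ : n ≡ suc (length L₂)
    n≡ = ℕ.suc-injective (begin
      suc n                          ≡⟨ n≡a+b ⟩
      length b ℕ.+ length a          ≡⟨ cong (length b ℕ.+_) |a|-split ⟩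
      length b ℕ.+ (length b ℕ.+ (length c ℕ.+ length b)) ≡⟨ shuffle₁ (length b) (length c) ⟩
      length b ℕ.+ length c ℕ.+ (length b ℕ.+ length b) ≡⟨ cong (ℕ._+ (length b ℕ.+ length b)) |bc| ⟩
      length l ℕ.+ (2 ℕ.+ length r) ℕ.+ (length b ℕ.+ length b) ≡⟨ shuffle₂ (length l) (length r) (length b) ⟩
      suc (suc (length r ℕ.+ (length b ℕ.+ (length b ℕ.+ length l)))) ≡⟨ cong (λ w → suc (suc w)) (sym |L₂|) ⟩
      suc (suc (length L₂))          ∎)
      where
      shuffle₁ : ∀ b c → b ℕ.+ (b ℕ.+ (c ℕ.+ b)) ≡ b ℕ.+ c ℕ.+ (b ℕ.+ b)
      shuffle₁ = ℕ-solve-∀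
      shuffle₂ : ∀ l r b → l ℕ.+ (2 ℕ.+ r) ℕ.+ (b ℕ.+ b) ≡ suc (suc (r ℕ.+ (b ℕ.+ (b ℕ.+ l))))
      shuffle₂ = ℕ-solve-∀
    z< : z ℕ.< length L₂ ℕ.+ (2 ℕ.+ length Z₂)
    -- This bound is nearly tight: the third swap starts at 2h′ + n, while `z` can reach 2h′ + n -
    -- 2.
    z< = ℕ.s≤s⁻¹ (ℕ.s≤s⁻¹ (ℕ.≤-trans (s≤s (s≤s (ℕ.+-mono-< i<b j<n))) (ℕ.≤-reflexive bound≡)))
      where
      shuffle₁ : ∀ b c → b ℕ.+ (c ℕ.+ b) ℕ.+ (b ℕ.+ (b ℕ.+ (c ℕ.+ b))) ≡ (b ℕ.+ c) ℕ.+ (b ℕ.+ c) ℕ.+ (b ℕ.+ (b ℕ.+ b))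
      shuffle₁ = ℕ-solve-∀
      shuffle₂ : ∀ l r b → l ℕ.+ (2 ℕ.+ r) ℕ.+ (l ℕ.+ (2 ℕ.+ r)) ℕ.+ (b ℕ.+ (b ℕ.+ b))
                 ≡ suc (suc (r ℕ.+ (b ℕ.+ (b ℕ.+ l)) ℕ.+ (2 ℕ.+ (r ℕ.+ (b ℕ.+ l)))))
      shuffle₂ = ℕ-solve-∀
      bound≡ : suc (suc (h′ ℕ.+ h′ ℕ.+ n)) ≡ suc (suc (length L₂ ℕ.+ (2 ℕ.+ length Z₂)))
      bound≡ = begin
        suc (suc (h′ ℕ.+ h′ ℕ.+ n))                        ≡⟨ sym (ℕ.+-suc (suc (h′ ℕ.+ h′)) n) ⟩
        suc (h′ ℕ.+ h′) ℕ.+ suc n                          ≡⟨ cong₂ ℕ._+_ (sym |a|≡) n≡a+b ⟩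
        length a ℕ.+ (length b ℕ.+ length a)               ≡⟨ cong (λ w → w ℕ.+ (length b ℕ.+ w)) |a|-split ⟩
        length b ℕ.+ (length c ℕ.+ length b) ℕ.+ (length b ℕ.+ (length b ℕ.+ (length c ℕ.+ length b)))
          ≡⟨ shuffle₁ (length b) (length c) ⟩
        (length b ℕ.+ length c) ℕ.+ (length b ℕ.+ length c) ℕ.+ (length b ℕ.+ (length b ℕ.+ length b))
          ≡⟨ cong (λ w → w ℕ.+ w ℕ.+ (length b ℕ.+ (length b ℕ.+ length b))) |bc| ⟩
        length l ℕ.+ (2 ℕ.+ length r) ℕ.+ (length l ℕ.+ (2 ℕ.+ length r)) ℕ.+ (length b ℕ.+ (length b ℕ.+ length b))
          ≡⟨ shuffle₂ (length l) (length r) (length b) ⟩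
        suc (suc (length r ℕ.+ (length b ℕ.+ (length b ℕ.+ length l)) ℕ.+ (2 ℕ.+ (length r ℕ.+ (length b ℕ.+ length l)))))
          ≡⟨ sym (cong₂ (λ u v → suc (suc (u ℕ.+ (2 ℕ.+ v)))) |L₂| (trans (length-++ r) (cong (length r ℕ.+_) (length-++ b)))) ⟩
        suc (suc (length L₂ ℕ.+ (2 ℕ.+ length Z₂))) ∎

  -- By `b+c`, N is the mean of the two lengths, of which |c| is not the larger.
  c≤N : length c ℕ.≤ N
  c≤N = ℕ.≮⇒≥ (λ N<c → ℕ.<-irrefl refl (ℕ.<-≤-trans (ℕ.+-mono-< N<c N<c)
    (subst (length c ℕ.+ length c ℕ.≤_) b+c (ℕ.+-monoˡ-≤ (length c) c≤b))))

  -- The root row starts at place m + |b| - 1 = |b| + N of the fixed point, that is, `d` letters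
  -- into the copy of `b` which follows bc.
  d : ℕ
  d = N ℕ.∸ length c

  b₁ b₂ : List ℕ
  b₁ = take d b
  b₂ = drop d b

  b₁++b₂ : b₁ ++ b₂ ≡ b
  b₁++b₂ = take++drop≡id d b

  prefix-conjugate : ∀ T → (a ++ b ++ a ++ a ++ a ++ b ++ a) ++ T
                     ≡ (b ++ c ++ b₁) ++ (b₂ ++ b₁) ++ (b₂ ++ a ++ a ++ a ++ b ++ a ++ T)
  prefix-conjugate T = begin
    (a ++ b ++ a ++ a ++ a ++ b ++ a) ++ T
      ≡⟨ cong (λ u → (u ++ b ++ a ++ a ++ a ++ b ++ a) ++ T) a≡ ⟩
    ((b ++ c ++ b) ++ b ++ a ++ a ++ a ++ b ++ a) ++ T
      ≡⟨ cong (λ u → ((b ++ c ++ u) ++ u ++ a ++ a ++ a ++ b ++ a) ++ T) (sym b₁++b₂) ⟩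
    ((b ++ c ++ b₁ ++ b₂) ++ (b₁ ++ b₂) ++ a ++ a ++ a ++ b ++ a) ++ T
      ≡⟨ regroup b₁ b₂ ⟩
    (b ++ c ++ b₁) ++ (b₂ ++ b₁) ++ (b₂ ++ a ++ a ++ a ++ b ++ a ++ T) ∎
    where
    regroup : ∀ u v → ((b ++ c ++ u ++ v) ++ (u ++ v) ++ a ++ a ++ a ++ b ++ a) ++ T
                      ≡ (b ++ c ++ u) ++ (v ++ u) ++ (v ++ a ++ a ++ a ++ b ++ a ++ T)
    regroup u v = solve (++-monoid ℕ)

  -- The first |b| entries of the root row are read across two adjacent copies of `b`, starting at
  -- offset `d`. They form the conjugate `b₂ ++ b₁`, which has the same letter sum as `b`.
  root-total : prefixSum (λ t → g (h ℕ.+ h ℕ.+ t)) (suc (h ℕ.+ h)) ≡ + N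
  root-total = begin
    prefixSum (λ t → g (h ℕ.+ h ℕ.+ t)) (suc (h ℕ.+ h))
      ≡⟨ cong (prefixSum (λ t → g (h ℕ.+ h ℕ.+ t))) (sym |b₂++b₁|) ⟩
    prefixSum (λ t → g (h ℕ.+ h ℕ.+ t)) (length (b₂ ++ b₁))
      ≡⟨ prefixSum-cong (length (b₂ ++ b₁)) letter ⟩
    prefixSum (λ t → + at (b₂ ++ b₁) t) (length (b₂ ++ b₁))
      ≡⟨ prefixSum-at (b₂ ++ b₁) ⟩
    + total (b₂ ++ b₁)
      ≡⟨ cong +_ (begin
           total (b₂ ++ b₁)          ≡⟨ total-++ b₂ b₁ ⟩
           total b₂ ℕ.+ total b₁     ≡⟨ ℕ.+-comm (total b₂) (total b₁) ⟩
           total b₁ ℕ.+ total b₂     ≡⟨ sym (total-++ b₁ b₂) ⟩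
           total (b₁ ++ b₂)          ≡⟨ cong total b₁++b₂ ⟩
           N                         ∎) ⟩
    + N ∎
    where
    |b₂++b₁| : length (b₂ ++ b₁) ≡ suc (h ℕ.+ h)
    |b₂++b₁| = begin
      length (b₂ ++ b₁)          ≡⟨ length-++ b₂ ⟩
      length b₂ ℕ.+ length b₁    ≡⟨ ℕ.+-comm (length b₂) (length b₁) ⟩
      length b₁ ℕ.+ length b₂    ≡⟨ sym (length-++ b₁) ⟩
      length (b₁ ++ b₂)          ≡⟨ cong length b₁++b₂ ⟩
      length b                   ≡⟨ |b|≡ ⟩
      suc (h ℕ.+ h)              ∎
    |bcb₁| : length (b ++ c ++ b₁) ≡ m ℕ.+ (h ℕ.+ h)
    |bcb₁| = begin
      length (b ++ c ++ b₁)                      ≡⟨ trans (length-++ b) (cong (length b ℕ.+_) (length-++ c)) ⟩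
      length b ℕ.+ (length c ℕ.+ length b₁)      ≡⟨ cong (λ w → length b ℕ.+ (length c ℕ.+ w)) (trans (length-take d b) (ℕ.m≤n⇒m⊓n≡m d≤b)) ⟩
      length b ℕ.+ (length c ℕ.+ d)              ≡⟨ cong₂ ℕ._+_ |b|≡ (ℕ.m+[n∸m]≡n c≤N) ⟩
      suc (h ℕ.+ h) ℕ.+ N                        ≡⟨ shuffle (h ℕ.+ h) N ⟩
      m ℕ.+ (h ℕ.+ h)                            ∎
      where
      d≤b : d ℕ.≤ length b
      d≤b = ℕ.≤-trans (ℕ.m∸n≤m N (length c)) (subst (N ℕ.≤_) total-bc (ℕ.m≤m+n N (total c)))
      shuffle : ∀ a N → suc a ℕ.+ N ≡ N ℕ.+ 1 ℕ.+ a
      shuffle = ℕ-solve-∀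
    letter : ∀ t → t ℕ.< length (b₂ ++ b₁) → g (h ℕ.+ h ℕ.+ t) ≡ + at (b₂ ++ b₁) t
    letter t t< with s-prefix (length (b ++ c ++ b₁) ℕ.+ t)
    ... | T , eq = cong +_ (begin
      s (m ℕ.+ (h ℕ.+ h ℕ.+ t))                   ≡⟨ cong s (trans (sym (ℕ.+-assoc m (h ℕ.+ h) t)) (cong (ℕ._+ t) (sym |bcb₁|))) ⟩
      s (length (b ++ c ++ b₁) ℕ.+ t)             ≡⟨ eq ⟩
      at ((a ++ b ++ a ++ a ++ a ++ b ++ a) ++ T) (length (b ++ c ++ b₁) ℕ.+ t)
        ≡⟨ cong (λ w → at w (length (b ++ c ++ b₁) ℕ.+ t)) (prefix-conjugate T) ⟩
      at ((b ++ c ++ b₁) ++ (b₂ ++ b₁) ++ (b₂ ++ a ++ a ++ a ++ b ++ a ++ T)) (length (b ++ c ++ b₁) ℕ.+ t)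
        ≡⟨ at-++ʳ (b ++ c ++ b₁) _ t ⟩
      at ((b₂ ++ b₁) ++ (b₂ ++ a ++ a ++ a ++ b ++ a ++ T)) t
        ≡⟨ at-++ˡ (b₂ ++ b₁) _ t t< ⟩
      at (b₂ ++ b₁) t ∎)

  H-window : H m n ≡ neg1^ (h ℕ.+ h′) * + N
  H-window = begin
    H m n
      ≡⟨ det-cong n (λ i j → cong (λ w → + s w) (ℕ.+-assoc m (toℕ i) (toℕ j))) ⟩
    det n (λ i j → g (toℕ i ℕ.+ toℕ j))
      ≡⟨ HankelDeterminant.det-hankel h h′ ε ε²≡1 g short-shift long-shift ⟩
    neg1^ (h ℕ.+ h′) * prefixSum (λ t → g (h ℕ.+ h ℕ.+ t)) (suc (h ℕ.+ h))
      ≡⟨ cong (λ u → neg1^ (h ℕ.+ h′) * u) root-total ⟩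
    neg1^ (h ℕ.+ h′) * + N ∎

-- Iterates of the substitution: lengths, letter counts, commutation

w u : ℕ → List ℕ
w k = τ^ k (1 ∷ [])
u k = τ^ k (0 ∷ [])

τ^-++ : ∀ k xs ys → τ^ k (xs ++ ys) ≡ τ^ k xs ++ τ^ k ys
τ^-++ zero xs ys = refl
τ^-++ (suc k) xs ys = trans (cong τ (τ^-++ k xs ys)) (concatMap-++ τ₁ (τ^ k xs) (τ^ k ys))

τ^-τ : ∀ k xs → τ^ (suc k) xs ≡ τ^ k (τ xs)
τ^-τ zero xs = refl
τ^-τ (suc k) xs = cong τ (τ^-τ k xs)

w-suc : ∀ k → w (suc k) ≡ w k ++ u k ++ w k
w-suc k = trans (τ^-τ k (1 ∷ [])) (trans (τ^-++ k (1 ∷ []) (0 ∷ 1 ∷ [])) (cong (w k ++_) (τ^-++ k (0 ∷ []) (1 ∷ []))))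

u-suc : ∀ k → u (suc k) ≡ w k
u-suc k = τ^-τ k (0 ∷ [])

measure-w-suc : ∀ (μ : List ℕ → ℕ) → (∀ xs ys → μ (xs ++ ys) ≡ μ xs ℕ.+ μ ys) →
                ∀ k → μ (w (suc k)) ≡ μ (w k) ℕ.+ (μ (u k) ℕ.+ μ (w k))
measure-w-suc μ μ-++ k = trans (cong μ (w-suc k)) (trans (μ-++ (w k) (u k ++ w k)) (cong (μ (w k) ℕ.+_) (μ-++ (u k) (w k))))

length-w-suc : ∀ k → length (w (suc k)) ≡ length (w k) ℕ.+ (length (u k) ℕ.+ length (w k))
length-w-suc = measure-w-suc length (λ xs ys → length-++ xs)

total-w-suc : ∀ k → total (w (suc k)) ≡ total (w k) ℕ.+ (total (u k) ℕ.+ total (w k))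
total-w-suc = measure-w-suc total total-++

-- For k ≥ 1 each 0 of τ^k(1) comes from exactly one 1 of τ^(k-1)(1) = τ^k(0), so `w k` has as many
-- zeros as `u k` has ones. The induction step of each of the two identities uses the other.
total-wu : ∀ k → total (w k) ℕ.+ total (u k) ≡ length (w k)
length-wu : ∀ k → length (w k) ℕ.+ length (u k) ≡ total (w k) ℕ.+ total (w k)

total-wu zero = refl
total-wu (suc k) = begin
  total (w (suc k)) ℕ.+ total (u (suc k))
    ≡⟨ cong₂ (λ x y → x ℕ.+ total y) (total-w-suc k) (u-suc k) ⟩
  total (w k) ℕ.+ (total (u k) ℕ.+ total (w k)) ℕ.+ total (w k)
    ≡⟨ shuffle₁ (total (w k)) (total (u k)) ⟩
  total (w k) ℕ.+ total (u k) ℕ.+ (total (w k) ℕ.+ total (w k))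
    ≡⟨ cong₂ ℕ._+_ (total-wu k) (sym (length-wu k)) ⟩
  length (w k) ℕ.+ (length (w k) ℕ.+ length (u k))
    ≡⟨ cong (length (w k) ℕ.+_) (ℕ.+-comm (length (w k)) (length (u k))) ⟩
  length (w k) ℕ.+ (length (u k) ℕ.+ length (w k))
    ≡⟨ sym (length-w-suc k) ⟩
  length (w (suc k)) ∎
  where
  shuffle₁ : ∀ x y → x ℕ.+ (y ℕ.+ x) ℕ.+ x ≡ x ℕ.+ y ℕ.+ (x ℕ.+ x)
  shuffle₁ = ℕ-solve-∀

length-wu zero = refl
length-wu (suc k) = begin
  length (w (suc k)) ℕ.+ length (u (suc k))
    ≡⟨ cong₂ (λ x y → x ℕ.+ length y) (length-w-suc k) (u-suc k) ⟩
  length (w k) ℕ.+ (length (u k) ℕ.+ length (w k)) ℕ.+ length (w k)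
    ≡⟨ shuffle₁ (length (w k)) (length (u k)) ⟩
  length (w k) ℕ.+ length (u k) ℕ.+ (length (w k) ℕ.+ length (w k))
    ≡⟨ cong₂ (λ x y → x ℕ.+ (y ℕ.+ y)) (length-wu k) (sym (total-wu k)) ⟩
  total (w k) ℕ.+ total (w k) ℕ.+ (total (w k) ℕ.+ total (u k) ℕ.+ (total (w k) ℕ.+ total (u k)))
    ≡⟨ shuffle₂ (total (w k)) (total (u k)) ⟩
  total (w k) ℕ.+ (total (u k) ℕ.+ total (w k)) ℕ.+ (total (w k) ℕ.+ (total (u k) ℕ.+ total (w k)))
    ≡⟨ sym (cong (λ x → x ℕ.+ x) (total-w-suc k)) ⟩
  total (w (suc k)) ℕ.+ total (w (suc k)) ∎
  where
  shuffle₁ : ∀ x y → x ℕ.+ (y ℕ.+ x) ℕ.+ x ≡ x ℕ.+ y ℕ.+ (x ℕ.+ x)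
  shuffle₁ = ℕ-solve-∀
  shuffle₂ : ∀ x y → x ℕ.+ x ℕ.+ (x ℕ.+ y ℕ.+ (x ℕ.+ y)) ≡ x ℕ.+ (y ℕ.+ x) ℕ.+ (x ℕ.+ (y ℕ.+ x))
  shuffle₂ = ℕ-solve-∀

length-u≤w : ∀ k → length (u k) ℕ.≤ length (w k)
length-u≤w zero = ℕ.≤-refl
length-u≤w (suc k) = subst₂ ℕ._≤_ (cong length (sym (u-suc k))) (sym (length-w-suc k)) (ℕ.m≤m+n (length (w k)) _)

record AlmostCommute (xs ys : List ℕ) (p : ℕ) : Set where
  field
    l r : List ℕ
    x y : ℕ
    xs++ys : xs ++ ys ≡ l ++ x ∷ y ∷ r
    ys++xs : ys ++ xs ≡ l ++ y ∷ x ∷ r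
    length-l : suc (length l) ≡ p
    unit : (+ y - + x) * (+ y - + x) ≡ + 1

-- At the next index wuw·w = w·uw·w and w·wuw = w·wu·w: the old pair is framed by w on both sides
-- while the two words exchange roles. Hence `x` and `y` trade places, and ε changes sign with every
-- k.
wu-almost-commute : ∀ k → AlmostCommute (w k) (u k) (total (w k))
wu-almost-commute zero = record
  { l = [] ; r = [] ; x = 1 ; y = 0 ; xs++ys = refl ; ys++xs = refl ; length-l = refl ; unit = refl }
wu-almost-commute (suc k) = record
  { l = w k ++ l ; r = r ++ w k ; x = y ; y = x
  ; xs++ys = begin
      w (suc k) ++ u (suc k)             ≡⟨ cong₂ _++_ (w-suc k) (u-suc k) ⟩
      (w k ++ u k ++ w k) ++ w k         ≡⟨ assoc₁ (w k) (u k) ⟩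
      w k ++ (u k ++ w k) ++ w k         ≡⟨ cong (λ v → w k ++ v ++ w k) ys++xs ⟩
      w k ++ (l ++ (y ∷ x ∷ []) ++ r) ++ w k ≡⟨ assoc₂ (w k) l (y ∷ x ∷ []) r ⟩
      (w k ++ l) ++ y ∷ x ∷ r ++ w k     ∎
  ; ys++xs = begin
      u (suc k) ++ w (suc k)             ≡⟨ cong₂ _++_ (u-suc k) (w-suc k) ⟩
      w k ++ (w k ++ u k ++ w k)         ≡⟨ assoc₃ (w k) (u k) ⟩
      w k ++ (w k ++ u k) ++ w k         ≡⟨ cong (λ v → w k ++ v ++ w k) xs++ys ⟩
      w k ++ (l ++ (x ∷ y ∷ []) ++ r) ++ w k ≡⟨ assoc₂ (w k) l (x ∷ y ∷ []) r ⟩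
      (w k ++ l) ++ x ∷ y ∷ r ++ w k     ∎
  ; length-l = begin
      suc (length (w k ++ l))            ≡⟨ cong suc (length-++ (w k)) ⟩
      suc (length (w k) ℕ.+ length l)    ≡⟨ sym (ℕ.+-suc (length (w k)) (length l)) ⟩
      length (w k) ℕ.+ suc (length l)    ≡⟨ cong₂ ℕ._+_ (sym (total-wu k)) length-l ⟩
      total (w k) ℕ.+ total (u k) ℕ.+ total (w k) ≡⟨ ℕ.+-assoc (total (w k)) (total (u k)) (total (w k)) ⟩
      total (w k) ℕ.+ (total (u k) ℕ.+ total (w k)) ≡⟨ sym (total-w-suc k) ⟩
      total (w (suc k))                  ∎
  ; unit = trans (flip (+ x) (+ y)) unit
  }
  where
  open AlmostCommute (wu-almost-commute k)
  flip : ∀ x y → (x - y) * (x - y) ≡ (y - x) * (y - x)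
  flip = solve-∀
  assoc₁ : ∀ a b → (a ++ b ++ a) ++ a ≡ a ++ (b ++ a) ++ a
  assoc₁ a b = solve (++-monoid ℕ)
  assoc₂ : ∀ a l v r → a ++ (l ++ v ++ r) ++ a ≡ (a ++ l) ++ v ++ (r ++ a)
  assoc₂ a l v r = solve (++-monoid ℕ)
  assoc₃ : ∀ a b → a ++ (a ++ b ++ a) ≡ a ++ (a ++ b) ++ a
  assoc₃ a b = solve (++-monoid ℕ)

k<length-w : ∀ k → k ℕ.< length (w k)
k<length-w zero = s≤s z≤n
k<length-w (suc k) = subst (suc k ℕ.<_) (sym (length-w-suc k))
  (ℕ.+-mono-≤ (ℕ.≤-trans (s≤s z≤n) (k<length-w k)) (ℕ.≤-trans (k<length-w k) (ℕ.m≤n+m (length (w k)) (length (u k)))))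

w-prefix : ∀ K d → ∃ λ T → w (d ℕ.+ K) ≡ w K ++ T
w-prefix K zero = [] , sym (++-identityʳ (w K))
w-prefix K (suc d) with w-prefix K d
... | T , eq = T ++ u (d ℕ.+ K) ++ w (d ℕ.+ K) ,
  trans (w-suc (d ℕ.+ K)) (trans (cong (_++ u (d ℕ.+ K) ++ w (d ℕ.+ K)) eq) (++-assoc (w K) T _))

-- Both `w K` and `w (suc q)` are prefixes of one later iterate, and the second is long enough to
-- contain place `q`.
s-in-w : ∀ K q → ∃ λ T → s q ≡ at (w K ++ T) q
s-in-w K q with w-prefix K (suc q) | w-prefix (suc q) K
... | T , eq | T′ , eq′ = T , (begin
  at (w (suc q)) q         ≡⟨ sym (at-++ˡ (w (suc q)) T′ q (ℕ.<-trans (ℕ.n<1+n q) (k<length-w (suc q)))) ⟩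
  at (w (suc q) ++ T′) q   ≡⟨ cong (λ v → at v q) (sym eq′) ⟩
  at (w (K ℕ.+ suc q)) q   ≡⟨ cong (λ v → at (w v) q) (ℕ.+-comm K (suc q)) ⟩
  at (w (suc q ℕ.+ K)) q   ≡⟨ cong (λ v → at v q) eq ⟩
  at (w K ++ T) q          ∎)

-- The matrix reads up to place m + 2n - 2. For k ≥ 1 this lies beyond the 2|wuw| + |w| letters of
-- τ^(k+2)(1), so one more iterate is taken.
w-suc³ : ∀ k → w (3 ℕ.+ k) ≡ w (1 ℕ.+ k) ++ w k ++ w (1 ℕ.+ k) ++ w (1 ℕ.+ k) ++ w (1 ℕ.+ k) ++ w k ++ w (1 ℕ.+ k)
w-suc³ k = begin
  w (3 ℕ.+ k)                                      ≡⟨ w-suc (2 ℕ.+ k) ⟩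
  w (2 ℕ.+ k) ++ u (2 ℕ.+ k) ++ w (2 ℕ.+ k)        ≡⟨ cong (λ v → w (2 ℕ.+ k) ++ v ++ w (2 ℕ.+ k)) (u-suc (1 ℕ.+ k)) ⟩
  w (2 ℕ.+ k) ++ w (1 ℕ.+ k) ++ w (2 ℕ.+ k)        ≡⟨ cong (λ v → v ++ w (1 ℕ.+ k) ++ v) w-suc² ⟩
  (w (1 ℕ.+ k) ++ w k ++ w (1 ℕ.+ k)) ++ w (1 ℕ.+ k) ++ (w (1 ℕ.+ k) ++ w k ++ w (1 ℕ.+ k))
                                                   ≡⟨ assoc (w (1 ℕ.+ k)) (w k) ⟩
  w (1 ℕ.+ k) ++ w k ++ w (1 ℕ.+ k) ++ w (1 ℕ.+ k) ++ w (1 ℕ.+ k) ++ w k ++ w (1 ℕ.+ k) ∎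
  where
  w-suc² : w (2 ℕ.+ k) ≡ w (1 ℕ.+ k) ++ w k ++ w (1 ℕ.+ k)
  w-suc² = trans (w-suc (1 ℕ.+ k)) (cong (λ v → w (1 ℕ.+ k) ++ v ++ w (1 ℕ.+ k)) (u-suc k))
  assoc : ∀ a b → (a ++ b ++ a) ++ a ++ (a ++ b ++ a) ≡ a ++ b ++ a ++ a ++ a ++ b ++ a
  assoc a b = solve (++-monoid ℕ)

-- This is (|w k| - 1)/2, half the size of an antidiagonal block; the recursion reflects |w (k+1)| =
-- |w k| + 2N with N the number of ones in `w k`.
half : ℕ → ℕ
half zero = 0
half (suc k) = half k ℕ.+ total (w k)

length-w-half : ∀ k → length (w k) ≡ suc (half k ℕ.+ half k)
length-w-half zero = refl
length-w-half (suc k) = begin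
  length (w (suc k))                                     ≡⟨ length-w-suc k ⟩
  length (w k) ℕ.+ (length (u k) ℕ.+ length (w k))       ≡⟨ shuffle₁ (length (w k)) (length (u k)) ⟩
  length (w k) ℕ.+ (length (w k) ℕ.+ length (u k))       ≡⟨ cong₂ ℕ._+_ (length-w-half k) (length-wu k) ⟩
  suc (half k ℕ.+ half k) ℕ.+ (total (w k) ℕ.+ total (w k)) ≡⟨ shuffle₂ (half k) (total (w k)) ⟩
  suc (half k ℕ.+ total (w k) ℕ.+ (half k ℕ.+ total (w k))) ∎
  where
  shuffle₁ : ∀ x y → x ℕ.+ (y ℕ.+ x) ≡ x ℕ.+ (x ℕ.+ y)
  shuffle₁ = ℕ-solve-∀
  shuffle₂ : ∀ x y → suc (x ℕ.+ x) ℕ.+ (y ℕ.+ y) ≡ suc (x ℕ.+ y ℕ.+ (x ℕ.+ y))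
  shuffle₂ = ℕ-solve-∀

neg1^-double : ∀ t → neg1^ (t ℕ.+ t) ≡ + 1
neg1^-double zero = refl
neg1^-double (suc t) = trans (cong (λ v → neg1^ (suc v)) (ℕ.+-suc t t)) (trans (neg1^-+2 (t ℕ.+ t)) (neg1^-double t))

-- From k to k + 1 the exponent grows by the sum of the letter counts of `w k` and `w (suc k)`.
-- These differ by |w k|, which is odd, so the sign flips at every step.
neg1^-half : ∀ k → neg1^ (half k ℕ.+ half (suc k)) ≡ neg1^ (suc k)
neg1^-half zero = refl
neg1^-half (suc k) = begin
  neg1^ (half (suc k) ℕ.+ (half (suc k) ℕ.+ total (w (suc k))))
    ≡⟨ cong neg1^ parity ⟩
  neg1^ (suc (half k ℕ.+ half (suc k) ℕ.+ (t ℕ.+ t)))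
    ≡⟨ cong (λ v → - (+ 1) * v) (trans (neg1^-+ (half k ℕ.+ half (suc k)) (t ℕ.+ t)) (trans (cong₂ _*_ (neg1^-half k) (neg1^-double t)) (*-identityʳ _))) ⟩
  neg1^ (suc (suc k)) ∎
  where
  t : ℕ
  t = half k ℕ.+ total (w k)
  parity : half (suc k) ℕ.+ (half (suc k) ℕ.+ total (w (suc k))) ≡ suc (half k ℕ.+ half (suc k) ℕ.+ (t ℕ.+ t))
  parity = begin
    t ℕ.+ (t ℕ.+ total (w (suc k)))
      ≡⟨ cong (λ v → t ℕ.+ (t ℕ.+ v)) (trans (total-w-suc k) (shuffle₁ (total (w k)) (total (u k)))) ⟩
    t ℕ.+ (t ℕ.+ (total (w k) ℕ.+ total (u k) ℕ.+ total (w k)))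
      ≡⟨ cong (λ v → t ℕ.+ (t ℕ.+ (v ℕ.+ total (w k)))) (trans (total-wu k) (length-w-half k)) ⟩
    t ℕ.+ (t ℕ.+ (suc (half k ℕ.+ half k) ℕ.+ total (w k)))
      ≡⟨ shuffle₂ (half k) (total (w k)) ⟩
    suc (half k ℕ.+ half (suc k) ℕ.+ (t ℕ.+ t)) ∎
    where
    shuffle₁ : ∀ x y → x ℕ.+ (y ℕ.+ x) ≡ x ℕ.+ y ℕ.+ x
    shuffle₁ = ℕ-solve-∀
    shuffle₂ : ∀ x y → x ℕ.+ y ℕ.+ (x ℕ.+ y ℕ.+ (suc (x ℕ.+ x) ℕ.+ y)) ≡ suc (x ℕ.+ (x ℕ.+ y) ℕ.+ (x ℕ.+ y ℕ.+ (x ℕ.+ y)))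
    shuffle₂ = ℕ-solve-∀

-- The values of f at odd indices, and the determinant

odd≡ : ∀ k → 2 ℕ.* k ℕ.+ 1 ≡ 1 ℕ.+ k ℕ.* 2
odd≡ = ℕ-solve-∀

odd-% : ∀ k → (2 ℕ.* k ℕ.+ 1) % 2 ≡ 1
odd-% k = trans (cong (_% 2) (odd≡ k)) ([m+kn]%n≡m%n 1 k 2)

odd-/ : ∀ k → (2 ℕ.* k ℕ.+ 1) / 2 ≡ k
odd-/ k = trans (cong (_/ 2) (odd≡ k)) (trans (+-distrib-/-∣ʳ 1 {k ℕ.* 2} {2} (divides k refl)) (m*n/n≡m k 2))

f-odd : ∀ k → f (2 ℕ.* k ℕ.+ 1) ≡ length (τ^ k (1 ∷ 0 ∷ []))
f-odd k rewrite odd-% k | odd-/ k = refl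

f-odd-length : ∀ k → f (2 ℕ.* k ℕ.+ 1) ≡ length (w k) ℕ.+ length (u k)
f-odd-length k = trans (f-odd k) (trans (cong length (τ^-++ k (1 ∷ []) (0 ∷ []))) (length-++ (w k)))

f-odd-half : ∀ k → f (2 ℕ.* k ℕ.+ 1) / 2 ≡ total (w k)
f-odd-half k = trans (cong (_/ 2) (trans (f-odd-length k) (trans (length-wu k) (double (total (w k)))))) (m*n/n≡m (total (w k)) 2)
  where
  double : ∀ x → x ℕ.+ x ≡ x ℕ.* 2
  double = ℕ-solve-∀

f-next : ∀ k → f (2 ℕ.* k ℕ.+ 3) ℕ.∸ 1 ≡ half k ℕ.+ half k ℕ.+ suc (half (suc k) ℕ.+ half (suc k) ℕ.+ 0)
f-next k = cong (ℕ._∸ 1) (begin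
  f (2 ℕ.* k ℕ.+ 3)                          ≡⟨ cong f (shuffle k) ⟩
  f (2 ℕ.* suc k ℕ.+ 1)                      ≡⟨ f-odd-length (suc k) ⟩
  length (w (suc k)) ℕ.+ length (u (suc k))  ≡⟨ cong₂ (λ v v′ → v ℕ.+ length v′) (length-w-half (suc k)) (u-suc k) ⟩
  suc (half (suc k) ℕ.+ half (suc k)) ℕ.+ length (w k)
    ≡⟨ trans (ℕ.+-comm _ (length (w k))) (cong₂ (λ v v′ → v ℕ.+ suc v′) (length-w-half k) (sym (ℕ.+-identityʳ _))) ⟩
  suc (half k ℕ.+ half k) ℕ.+ suc (half (suc k) ℕ.+ half (suc k) ℕ.+ 0) ∎)
  where
  shuffle : ∀ k → 2 ℕ.* k ℕ.+ 3 ≡ 2 ℕ.* suc k ℕ.+ 1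
  shuffle = ℕ-solve-∀

theorem5 : (k : ℕ) → 1 ℕ.≤ k →
    H (f (2 ℕ.* k ℕ.+ 1) / 2 ℕ.+ 1) (f (2 ℕ.* k ℕ.+ 3) ℕ.∸ 1) ≡ neg1^ (k ℕ.+ 1) * (+ (f (2 ℕ.* k ℕ.+ 1) / 2))
theorem5 k _ = begin
  H (f (2 ℕ.* k ℕ.+ 1) / 2 ℕ.+ 1) (f (2 ℕ.* k ℕ.+ 3) ℕ.∸ 1)
    ≡⟨ cong₂ (λ v v′ → H (v ℕ.+ 1) v′) (f-odd-half k) (f-next k) ⟩
  H (total (w k) ℕ.+ 1) (half k ℕ.+ half k ℕ.+ suc (half (suc k) ℕ.+ half (suc k) ℕ.+ 0))
    ≡⟨ Window.H-window (w (suc k)) (w k) (u k) l r x y (half k) (half (suc k))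
         (w-suc k) xs++ys ys++xs unit (length-w-half k) (length-w-half (suc k)) length-l
         (length-wu k) (total-wu k) (length-u≤w k)
         (subst (λ v → ∀ q → ∃ λ T → s q ≡ at (v ++ T) q) (w-suc³ k) (s-in-w (3 ℕ.+ k))) ⟩
  neg1^ (half k ℕ.+ half (suc k)) * + total (w k)
    ≡⟨ cong₂ (λ v v′ → v * + v′) (trans (neg1^-half k) (cong neg1^ (ℕ.+-comm 1 k))) (sym (f-odd-half k)) ⟩
  neg1^ (k ℕ.+ 1) * + (f (2 ℕ.* k ℕ.+ 1) / 2) ∎
  where
  open AlmostCommute (wu-almost-commute k)
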